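{- For every finite tree $T$, its $2$-suppression $\overline T$ satisfies $$\mathrm{DN}_{\mathrm{LLY}}(\overline T)\le \mathrm{DN}_{\mathrm{LLY}}(T).$$
   Context: Graphs are simple and undirected. Let $d(\cdot,\cdot)$ be the combinatorial graph distance. For a positive edge weight $w:E\to(0,\infty)$ put $d_x^w:=\sum_{y\sim x}w_{xy}$. For $\alpha\in[0,1]$ let $\mu_x^{\alpha,w}$ be the probability measure with $\mu_x^{\alpha,w}(x)=\alpha$, $\mu_x^{\alpha,w}(z)=(1-\alpha)w_{xz}/d_x^w$ for $z\sim x$, and $0$ otherwise. Let $W_1$ be the $1$-Wasserstein distance with respect to $d$. For $x\sim y$ let $\kappa_\alpha^w(x,y):=1-W_1(\mu_x^{\alpha,w},\mu_y^{\alpha,w})$ and define the weighted Lin--Lu--Yau curvature $\kappa_{\mathrm{LLY}}^w(x,y):=\lim_{\alpha\to1^- }\kappa_\alpha^w(x,y)/(1-\alpha)$. For connected locally finite $G$ with $E\neq\varnothing$: $\mathrm{Dist}(w):=\sup_{e\in E}w_e/\inf_{e\in E}w_e$, with value $+\infty$ if the supremum is infinite or the infimum is $0$; a positive weight $w$ is admissible if $\kappa_{\mathrm{LLY}}^w(e)\ge0$ for every $e\in E$; and $\mathrm{DN}_{\mathrm{LLY}}(G):=\inf\{\mathrm{Dist}(w): w \text{ admissible}\}$, with value $+\infty$ if no admissible weight has finite distortion. By convention $\mathrm{DN}_{\mathrm{LLY}}(K_1)=1$. If $v$ is a vertex of degree $2$ of a finite tree with neighbors $x$ and $y$, suppressing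 $v$ means deleting $v$ and the edges $xv,vy$, and adding the edge $xy$. The $2$-suppression $\overline T$ of $T$ is obtained by repeatedly suppressing degree-two vertices until none remain. -}

module Defs where

open import Algebra.Bundles using (CommutativeRing)
import Algebra.Properties.CommutativeMonoid.Sum as Sum
import Algebra.Properties.Semiring.Mult as Mult
import Algebra.Properties.Ring as RingProperties
open import Algebra.Structures using (IsCommutativeRing)
open import Data.Bool.Base using (if_then_else_)
open import Data.Empty using (⊥-elim)
open import Data.Fin.Base using (Fin; punchIn)
open import Data.Fin.Properties using (_≟_)
open import Data.List.Base using (List; []; _∷_; _++_; length; filter; allFin)
open import Data.List.Relation.Unary.Linked using (Linked)
open import Data.List.Relation.Unary.Unique.Propositional using (Unique)
open import Data.Nat.Base as ℕ using (ℕ; suc)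
open import Data.Product.Base using (_×_; _,_; ∃; ∃₂; ∃-syntax; proj₁; proj₂)
open import Data.Sum.Base using (_⊎_; inj₁; inj₂)
import Data.Sum.Base as ⊎
open import Function.Base using (flip)
open import Level using (0ℓ)
open import Relation.Binary.Core using (Rel)
open import Relation.Binary.Definitions using (Decidable; Symmetric; Irreflexive)
open import Relation.Binary.PropositionalEquality using (_≡_; _≢_; refl; sym; trans; cong; subst)
import Relation.Binary.Construct.Add.Supremum.NonStrict as AddSupremum
import Relation.Binary.Construct.NonStrictToStrict as ToStrict
open import Relation.Binary.Structures using (IsDecTotalOrder)
open import Relation.Nullary using (¬_; does; _⊎-dec_; _×-dec_)
open import Relation.Nullary.Construct.Add.Supremum using (_⁺; [_]; ⊤⁺)

------------------------------------------------------------------------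
-- Suprema and infima

IsSup : ∀ {A : Set} → Rel A 0ℓ → (A → Set) → A → Set
IsSup _≤_ P s = (∀ {a} → P a → a ≤ s) × (∀ b → (∀ {a} → P a → a ≤ b) → s ≤ b)

IsInf : ∀ {A : Set} → Rel A 0ℓ → (A → Set) → A → Set
IsInf _≤_ = IsSup (flip _≤_)

------------------------------------------------------------------------
-- The real numbers

-- The library has no type of real numbers.  They are axiomatised here
-- in the classical way, as a (Dedekind-)complete ordered field; such a
-- field is unique up to isomorphism.

record CompleteOrderedField : Set₁ where
  infix  4 _≤_ _<_
  infixl 6 _+_ _-_
  infixl 7 _*_ _/_
  infix  8 -_ _⁻¹

  field
    ℝ       : Set
    _≤_     : Rel ℝ 0ℓ
    _+_ _*_ : ℝ → ℝ → ℝ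
    -_ _⁻¹  : ℝ → ℝ
    0# 1#   : ℝ

    isCommutativeRing : IsCommutativeRing _≡_ _+_ _*_ -_ 0# 1#
    0≢1               : 0# ≢ 1#
    -- The value of 0# ⁻¹ is left unspecified.
    *-inverseʳ        : ∀ x → x ≢ 0# → x * x ⁻¹ ≡ 1#

    isDecTotalOrder   : IsDecTotalOrder _≡_ _≤_
    +-monoˡ-≤         : ∀ z {x y} → x ≤ y → x + z ≤ y + z
    *-nonNegative     : ∀ {x y} → 0# ≤ x → 0# ≤ y → 0# ≤ x * y

    complete          : (P : ℝ → Set) → ∃ P → (∃[ b ] (∀ {a} → P a → a ≤ b)) →
                        ∃[ s ] IsSup _≤_ P s

  _<_ : Rel ℝ 0ℓ
  _<_ = ToStrict._<_ _≡_ _≤_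

  commutativeRing : CommutativeRing 0ℓ 0ℓ
  commutativeRing = record { isCommutativeRing = isCommutativeRing }

  _-_ _/_ : ℝ → ℝ → ℝ
  x - y = x + - y
  x / y = x * y ⁻¹

  open Sum (CommutativeRing.+-commutativeMonoid commutativeRing) public
    using (sum)
  open Mult (CommutativeRing.semiring commutativeRing) public
    using () renaming (_×_ to _·_)

  -- The reals extended by +∞, which is written ⊤⁺.
  ℝ∞ : Set
  ℝ∞ = ℝ ⁺

  open AddSupremum _≤_ public using ([_]; _≤⊤⁺) renaming (_≤⁺_ to _≤∞_)

------------------------------------------------------------------------
-- Finite simple graphs

record Graph (n : ℕ) : Set₁ where
  infix 4 _~_ _~?_
  field
    _~_      : Rel (Fin n) 0ℓ
    _~?_     : Decidable _~_
    ~-sym    : Symmetric _~_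
    ~-irrefl : Irreflexive _≡_ _~_

module _ {n : ℕ} (G : Graph n) where
  open Graph G

  HasEdge : Set
  HasEdge = ∃₂ λ x y → x ~ y

  degree : Fin n → ℕ
  degree x = length (filter (x ~?_) (allFin n))

  infixr 5 _∷_

  data Walk : ℕ → Fin n → Fin n → Set where
    []  : ∀ {x} → Walk 0 x x
    _∷_ : ∀ {k x y z} → x ~ y → Walk k y z → Walk (suc k) x z

  IsDistance : (Fin n → Fin n → ℕ) → Set
  IsDistance d = ∀ x y → Walk (d x y) x y × (∀ {k} → Walk k x y → d x y ℕ.≤ k)

  -- The empty graph is not connected.
  Connected : Set
  Connected = Fin n × (∀ x y → ∃[ k ] Walk k x y)

  -- The vertices x ∷ xs, listed in cyclic order.
  IsCycle : Fin n → List (Fin n) → Set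
  IsCycle x xs = 3 ℕ.≤ length (x ∷ xs) × Unique (x ∷ xs) × Linked _~_ (x ∷ xs ++ x ∷ [])

  IsTree : Set
  IsTree = Connected × (∀ x xs → ¬ IsCycle x xs)

------------------------------------------------------------------------
-- Suppression of vertices of degree two

-- The vertices other than v are relabelled along punchIn v.

suppress : ∀ {n} → Graph (suc n) → (v x y : Fin (suc n)) → x ≢ y → Graph n
suppress {n} G v x y x≢y = record
  { _~_      = _~′_
  ; _~?_     = λ a b → (punchIn v a ~? punchIn v b) ⊎-dec (new? a b ⊎-dec new? b a)
  ; ~-sym    = ⊎.map ~-sym ⊎.swap
  ; ~-irrefl = λ { refl (inj₁ a~a)               → ~-irrefl refl a~a
                 ; refl (inj₂ (inj₁ (a≡x , a≡y))) → x≢y (trans (sym a≡x) a≡y)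
                 ; refl (inj₂ (inj₂ (a≡x , a≡y))) → x≢y (trans (sym a≡x) a≡y) }
  }
  where
  open Graph G

  New : Rel (Fin n) 0ℓ
  New a b = punchIn v a ≡ x × punchIn v b ≡ y

  new? : Decidable New
  new? a b = (punchIn v a ≟ x) ×-dec (punchIn v b ≟ y)

  _~′_ : Rel (Fin n) 0ℓ
  a ~′ b = (punchIn v a ~ punchIn v b) ⊎ (New a b ⊎ New b a)

-- TwoSuppression G H: H arises from G by suppressing vertices of degree
-- two, in some order, until none remain.

data TwoSuppression : ∀ {m n} → Graph m → Graph n → Set₁ where
  done : ∀ {n} {G : Graph n} → (∀ v → degree G v ≢ 2) → TwoSuppression G G
  step : ∀ {m n} {G : Graph (suc m)} {H : Graph n} (let open Graph G)
         (v x y : Fin (suc m)) (x≢y : x ≢ y) →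
         degree G v ≡ 2 → v ~ x → v ~ y →
         TwoSuppression (suppress G v x y x≢y) H → TwoSuppression G H

------------------------------------------------------------------------
-- Weighted Lin–Lu–Yau curvature

module Curvature (R : CompleteOrderedField) where
  open CompleteOrderedField R

  module _ {n : ℕ} (G : Graph n) where
    open Graph G

    -- A positive function on edges; the values of w at non-adjacent
    -- pairs are irrelevant.
    record Weight : Set where
      field
        w        : Fin n → Fin n → ℝ
        w-sym    : ∀ {x y} → x ~ y → w x y ≡ w y x
        positive : ∀ {x y} → x ~ y → 0# < w x y

    module _ (𝓌 : Weight) where
      open Weight 𝓌

      weightedDegree : Fin n → ℝ
      weightedDegree x = sum λ y → if does (x ~? y) then w x y else 0#

      μ : ℝ → Fin n → Fin n → ℝ
      μ α x z =
        if does (z ≟ x) then α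
        else if does (x ~? z) then (1# - α) * w x z / weightedDegree x
        else 0#

    IsCoupling : (Fin n → ℝ) → (Fin n → ℝ) → (Fin n → Fin n → ℝ) → Set
    IsCoupling ρ σ π =
      (∀ x y → 0# ≤ π x y) ×
      (∀ x → (sum λ y → π x y) ≡ ρ x) ×
      (∀ y → (sum λ x → π x y) ≡ σ y)

    cost : (Fin n → Fin n → ℕ) → (Fin n → Fin n → ℝ) → ℝ
    cost d π = sum λ x → sum λ y → d x y · π x y

    -- IsW₁ ρ σ W: the 1-Wasserstein distance of ρ and σ is W.
    IsW₁ : (Fin n → ℝ) → (Fin n → ℝ) → ℝ → Set
    IsW₁ ρ σ W = ∃[ d ] IsDistance G d ×
      IsInf _≤_ (λ c → ∃[ π ] IsCoupling ρ σ π × c ≡ cost d π) W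

    module _ (𝓌 : Weight) where
      open Weight 𝓌

      Isκ : ℝ → Fin n → Fin n → ℝ → Set
      Isκ α x y k = ∃[ W ] IsW₁ (μ 𝓌 α x) (μ 𝓌 α y) W × k ≡ 1# - W

      -- κ is the limit of κ_α(x,y) / (1 - α) as α tends to 1 from below.
      IsκLLY : Fin n → Fin n → ℝ → Set
      IsκLLY x y κ =
        ∀ ε → 0# < ε → ∃[ δ ] 0# < δ ×
        (∀ α → 0# ≤ α → 1# - δ < α → α < 1# →
          ∃[ k ] Isκ α x y k × - ε < k / (1# - α) - κ × k / (1# - α) - κ < ε)

      Admissible : Set
      Admissible = ∀ {x y} → x ~ y → ∃[ κ ] IsκLLY x y κ × 0# ≤ κ

      EdgeValue : ℝ → Set
      EdgeValue r = ∃₂ λ x y → x ~ y × r ≡ w x y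

      data IsDist : ℝ∞ → Set where
        finite     : ∀ {s i} → IsSup _≤_ EdgeValue s → IsInf _≤_ EdgeValue i →
                     0# < i → IsDist [ s / i ]
        unbounded  : ¬ (∃[ b ] (∀ {r} → EdgeValue r → r ≤ b)) → IsDist ⊤⁺
        degenerate : IsInf _≤_ EdgeValue 0# → IsDist ⊤⁺

    AdmissibleDist : ℝ∞ → Set
    AdmissibleDist D = ∃[ 𝓌 ] Admissible 𝓌 × IsDist 𝓌 D

    -- IsDN D: the invariant DN_LLY(G) is D.  The infimum is taken in the
    -- reals extended by +∞, so that it is +∞ if no admissible weight has
    -- finite distortion.
    data IsDN : ℝ∞ → Set where
      single  : n ≡ 1 → IsDN [ 1# ]
      infimum : ∀ {D} → HasEdge G → IsInf _≤∞_ AdmissibleDist D → IsDN D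

    -- Classically, DN_LLY(G) exists; it is unique, being an infimum.

    private
      ring = CommutativeRing.ring commutativeRing
      open CommutativeRing commutativeRing using
        (+-identityˡ; -‿inverseˡ; -‿inverseʳ; *-identityˡ)
      open RingProperties ring using (-‿distribʳ-*; -‿distribˡ-*; -‿involutive)
      open IsDecTotalOrder isDecTotalOrder using (total; antisym)
        renaming (trans to ≤-trans)

      neg-nonNegative : ∀ {x} → x ≤ 0# → 0# ≤ - x
      neg-nonNegative {x} x≤0 =
        subst (_≤ - x) (-‿inverseʳ x)
          (subst (x + - x ≤_) (+-identityˡ (- x)) (+-monoˡ-≤ (- x) x≤0))

      0≤1 : 0# ≤ 1#
      0≤1 with total 0# 1#
      ... | inj₁ p = p
      ... | inj₂ 1≤0 = subst (0# ≤_) eq (*-nonNegative 0≤-1 0≤-1)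
        where
        0≤-1 = neg-nonNegative 1≤0
        eq : - 1# * - 1# ≡ 1#
        eq = trans (sym (-‿distribˡ-* 1# (- 1#)))
               (trans (cong -_ (*-identityˡ (- 1#))) (-‿involutive 1#))

      0≤⁻¹ : ∀ {x} → 0# < x → 0# ≤ x ⁻¹
      0≤⁻¹ {x} (0≤x , 0≢x) with total 0# (x ⁻¹)
      ... | inj₁ p = p
      ... | inj₂ x⁻¹≤0 = ⊥-elim (0≢1 (antisym 0≤1 1≤0))
        where
        0≤-1 : 0# ≤ - 1#
        0≤-1 = subst (0# ≤_)
          (trans (sym (-‿distribʳ-* x (x ⁻¹))) (cong -_ (*-inverseʳ x λ x≡0 → 0≢x (sym x≡0))))
          (*-nonNegative 0≤x (neg-nonNegative x⁻¹≤0))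
        1≤0 : 1# ≤ 0#
        1≤0 = subst (1# ≤_) (-‿inverseˡ 1#)
          (subst (_≤ - 1# + 1#) (+-identityˡ 1#) (+-monoˡ-≤ 1# 0≤-1))

      0≤Dist : HasEdge G → ∀ {r} → AdmissibleDist [ r ] → 0# ≤ r
      0≤Dist (x , y , x~y) (𝓌 , _ , finite (s-upper , _) _ 0<i) =
        *-nonNegative
          (≤-trans (proj₁ (Weight.positive 𝓌 x~y)) (s-upper (x , y , x~y , refl)))
          (0≤⁻¹ 0<i)

    DN-exists : n ≡ 1 ⊎ HasEdge G → ¬ ¬ ∃ IsDN
    DN-exists (inj₁ n≡1)  ¬DN = ¬DN (_ , single n≡1)
    DN-exists (inj₂ edge) ¬DN = ¬DN (⊤⁺ , infimum edge (bound , λ b _ → b ≤⊤⁺))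
      where
      LowerBound : ℝ → Set
      LowerBound b = ∀ {r} → AdmissibleDist [ r ] → b ≤ r

      noFinite : ∀ r → ¬ AdmissibleDist [ r ]
      noFinite r Dr = ¬DN ([ g ] , infimum edge (lower , greatest))
        where
        lub = complete LowerBound (0# , 0≤Dist edge) (r , λ lb → lb Dr)
        g   = proj₁ lub

        lower : ∀ {D} → AdmissibleDist D → [ g ] ≤∞ D
        lower {⊤⁺}    _  = _ ≤⊤⁺
        lower {[ _ ]} Da = [ proj₂ (proj₂ lub) _ (λ lb → lb Da) ]

        greatest : ∀ D → (∀ {D′} → AdmissibleDist D′ → D ≤∞ D′) → D ≤∞ [ g ]
        greatest ⊤⁺    lb with () ← lb Dr
        greatest [ b ] lb = [ proj₁ (proj₂ lub) (λ Da → AddSupremum.[≤]-injective _ (lb Da)) ]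

      bound : ∀ {D} → AdmissibleDist D → ⊤⁺ ≤∞ D
      bound {⊤⁺}    _  = _ ≤⊤⁺
      bound {[ r ]} Dr = ⊥-elim (noFinite r Dr)

{-# OPTIONS --safe #-}
-- On a tree the curvature of an edge xy is 2 (w/D x + w/D y - 1), where
-- D is the weighted degree: the optimal transport between the balls of x
-- and y crosses the bridge xy.  So w is admissible iff
-- D x D y ≤ w (D x + D y) on every edge, which says that w² is at least
-- the product of the weight sums of the other edges at the two ends; in
-- particular w is log-concave along walks without backtracking.
--
-- Let v have the neighbours x and y, with a = w(x,v) ≤ b = w(v,y).  By
-- log-concavity every edge e on the side of x satisfies b w(e) ≤ a².
-- Scale that side by b/a and give the new edge xy the weight b.  This
-- preserves admissibility, and the new weights lie between the old
-- extreme ones, as the scaled ones only grow, up to at most a.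
module Submission where

open import Defs
open import Data.Nat.Base using (ℕ)
open import Algebra.Bundles using (CommutativeRing)
import Algebra.Properties.Ring as RingProperties
import Algebra.Properties.Semiring.Mult as Mult
import Algebra.Properties.Semiring.Sum as Sum
import Algebra.Solver.Ring.NaturalCoefficients.Default as SemiringSolver
open import Data.Bool.Base using (Bool; true; false; if_then_else_)
open import Data.Empty using (⊥-elim)
open import Data.Fin.Base using (Fin; zero; suc; punchIn; punchOut)
open import Data.Fin.Properties using (_≟_; any?; punchInᵢ≢i; punchIn-injective; punchIn-punchOut)
open import Data.List.Base using (List; []; _∷_; _++_; length; filter; allFin)
open import Data.List.Membership.Propositional using (_∈_)
open import Data.List.Membership.Propositional.Properties using (∈-filter⁺; ∈-allFin)
open import Data.List.Properties using (++-assoc; length-++)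
open import Data.List.Relation.Binary.Disjoint.Propositional using (Disjoint)
open import Data.List.Relation.Unary.All as All using (All; []; _∷_)
open import Data.List.Relation.Unary.All.Properties using (¬Any⇒All¬)
open import Data.List.Relation.Unary.AllPairs using ([]; _∷_)
open import Data.List.Relation.Unary.Any as Any using (here; there)
open import Data.List.Relation.Unary.Linked using (Linked; [-]; _∷_)
open import Data.List.Relation.Unary.Unique.Propositional using (Unique)
open import Data.List.Relation.Unary.Unique.Propositional.Properties using (++⁺)
open import Data.Nat.Base as ℕ using (zero; suc; z≤n; s≤s)
import Data.Nat.Properties as ℕ
import Data.Nat.Solver as ℕ
open import Data.Product.Base using (_×_; _,_; ∃; ∃-syntax; proj₁; proj₂)
open import Data.Sum.Base as ⊎ using (_⊎_; inj₁; inj₂)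
open import Function.Base using (_∘_)
open import Level using (0ℓ)
open import Relation.Binary.Construct.Closure.ReflexiveTransitive using (Star; ε; _◅_; reverse)
open import Relation.Binary.Core using (Rel)
open import Relation.Binary.PropositionalEquality
  using (_≡_; _≢_; refl; sym; trans; cong; cong₂; subst; subst₂; module ≡-Reasoning)
open import Relation.Binary.Structures using (IsDecTotalOrder)
open import Relation.Nullary
  using (¬_; Dec; yes; no; does; contradiction; map′; _×-dec_)
open import Relation.Nullary.Construct.Add.Supremum using ([_]; ⊤⁺)
open import Relation.Nullary.Decidable using (dec-true; dec-false)

-- Why rescale at all: let A be the sum of the other weights at `x` and B that at `y`. Balance of xv
-- and vy says A b ≤ a² and B a ≤ b². Weight a on xy with nothing rescaled would need A B ≤ a²,
-- while only A B ≤ a b is known; weight b would enlarge the sum that the other edges at `x` have to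
-- dominate. Scaling the side of `x` by b/a makes the lost edge xv and the new edge xy agree there,
-- so every weighted degree is multiplied exactly by the factor of its side and old edges keep their
-- homogeneous inequality. For xy itself, (b/a) A ≤ a and B ≤ b²/a have product at most b². Of the
-- tree, the induction keeps connectedness and, for each edge, a two-colouring that makes it a
-- bridge. Both pass to the suppressed graph without any handling of cycles.

if-yes : ∀ {a p} {A : Set a} {P : Set p} (P? : Dec P) {x y : A} → P →
         (if does P? then x else y) ≡ x
if-yes (yes _) _ = refl
if-yes (no ¬p) p = contradiction p ¬p

if-no : ∀ {a p} {A : Set a} {P : Set p} (P? : Dec P) {x y : A} → ¬ P →
        (if does P? then x else y) ≡ y
if-no (yes p) ¬p = contradiction p ¬p
if-no (no _)  _  = refl

-- Arithmetic of ordered fields and finite sums.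

module OrderedField (R : CompleteOrderedField) where
  open CompleteOrderedField R

  open CommutativeRing commutativeRing public
    using (+-comm; +-assoc; +-identityˡ; +-identityʳ; -‿inverseˡ; -‿inverseʳ;
           *-comm; *-assoc; *-identityˡ; *-identityʳ; zeroˡ; zeroʳ; distribˡ)
  open RingProperties (CommutativeRing.ring commutativeRing) public
    using (-‿distribˡ-*; -‿distribʳ-*; -‿involutive; +-cancelʳ; +-cancelˡ)
  open Mult (CommutativeRing.semiring commutativeRing) public
    using (×-homo-+)
  open Sum (CommutativeRing.semiring commutativeRing) public
    using (sum-cong-≗; sum-remove; sum-replicate-zero; ∑-distrib-+; ∑-comm; *-distribˡ-sum)
  open IsDecTotalOrder isDecTotalOrder public
    using (total; antisym; _≤?_)
    renaming (refl to ≤-refl; reflexive to ≤-reflexive; trans to ≤-trans)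
  module Solver = SemiringSolver (CommutativeRing.commutativeSemiring commutativeRing)
  open Solver using (solve; _:=_; _:+_; _:*_; con)

  +-monoʳ-≤ : ∀ z {x y} → x ≤ y → z + x ≤ z + y
  +-monoʳ-≤ z x≤y = subst₂ _≤_ (+-comm _ z) (+-comm _ z) (+-monoˡ-≤ z x≤y)

  +-mono-≤ : ∀ {x y u v} → x ≤ y → u ≤ v → x + u ≤ y + v
  +-mono-≤ x≤y u≤v = ≤-trans (+-monoˡ-≤ _ x≤y) (+-monoʳ-≤ _ u≤v)

  +-cancelʳ-≤ : ∀ z {x y} → x + z ≤ y + z → x ≤ y
  +-cancelʳ-≤ z {x} {y} p = subst₂ _≤_ (lem x) (lem y) (+-monoˡ-≤ (- z) p)
    where
    lem : ∀ t → t + z + - z ≡ t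
    lem t = trans (+-assoc t z (- z)) (trans (cong (t +_) (-‿inverseʳ z)) (+-identityʳ t))

  -- Every linear consequence of an inequality is obtained in this form,
  -- leaving an identity of commutative semirings.
  ≤-balance : ∀ {p q x y} → p ≤ q → x + q ≡ y + p → x ≤ y
  ≤-balance {p} {q} {x} {y} p≤q eq =
    +-cancelʳ-≤ q (≤-trans (≤-reflexive eq) (+-monoʳ-≤ y p≤q))

  <-balance : ∀ {p q x y} → p < q → x + q ≡ y + p → x < y
  <-balance {p} {q} {x} (p≤q , p≢q) eq = ≤-balance p≤q eq , λ { refl → p≢q (sym (+-cancelˡ x q p eq)) }

  0≤-diff : ∀ {x y} → x ≤ y → 0# ≤ y - x
  0≤-diff {x} x≤y = subst (_≤ _) (-‿inverseʳ x) (+-monoˡ-≤ (- x) x≤y)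

  diff-+ : ∀ x y → (y - x) + x ≡ y
  diff-+ x y = trans (+-assoc y (- x) x) (trans (cong (y +_) (-‿inverseˡ x)) (+-identityʳ y))

  x≤x+y : ∀ {x y} → 0# ≤ y → x ≤ x + y
  x≤x+y {x} {y} 0≤y = subst (_≤ x + y) (+-identityʳ x) (+-monoʳ-≤ x 0≤y)

  0≤+ : ∀ {x y} → 0# ≤ x → 0# ≤ y → 0# ≤ x + y
  0≤+ 0≤x 0≤y = ≤-trans 0≤x (x≤x+y 0≤y)

  *-monoʳ-≤ : ∀ {z x y} → 0# ≤ z → x ≤ y → z * x ≤ z * y
  *-monoʳ-≤ {z} {x} {y} 0≤z x≤y =
    subst (z * x ≤_) eq (x≤x+y (*-nonNegative 0≤z (0≤-diff x≤y)))
    where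
    eq : z * x + z * (y - x) ≡ z * y
    eq = trans (sym (distribˡ z x (y - x)))
           (cong (z *_) (trans (+-comm x (y - x)) (diff-+ x y)))

  *-monoˡ-≤ : ∀ {z x y} → 0# ≤ z → x ≤ y → x * z ≤ y * z
  *-monoˡ-≤ 0≤z x≤y = subst₂ _≤_ (*-comm _ _) (*-comm _ _) (*-monoʳ-≤ 0≤z x≤y)

  0≤x*x : ∀ x → 0# ≤ x * x
  0≤x*x x with total 0# x
  ... | inj₁ 0≤x = *-nonNegative 0≤x 0≤x
  ... | inj₂ x≤0 = subst (0# ≤_) eq (*-nonNegative 0≤-x 0≤-x)
    where
    0≤-x : 0# ≤ - x
    0≤-x = subst (0# ≤_) (+-identityˡ (- x)) (0≤-diff x≤0)
    eq : - x * - x ≡ x * x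
    eq = trans (sym (-‿distribˡ-* x (- x)))
           (trans (cong -_ (sym (-‿distribʳ-* x x))) (-‿involutive (x * x)))

  0≤1 : 0# ≤ 1#
  0≤1 = subst (0# ≤_) (*-identityˡ 1#) (0≤x*x 1#)

  0<1 : 0# < 1#
  0<1 = 0≤1 , 0≢1

  ≰⇒> : ∀ {x y} → ¬ x ≤ y → y < x
  ≰⇒> {x} {y} x≰y with total x y
  ... | inj₁ x≤y = contradiction x≤y x≰y
  ... | inj₂ y≤x = y≤x , λ { refl → x≰y ≤-refl }

  <⇒≱ : ∀ {x y} → x < y → ¬ y ≤ x
  <⇒≱ (x≤y , x≢y) y≤x = x≢y (antisym x≤y y≤x)

  <-≤-trans : ∀ {x y z} → x < y → y ≤ z → x < z
  <-≤-trans x<y@(x≤y , _) y≤z = ≤-trans x≤y y≤z , λ { refl → <⇒≱ x<y y≤z }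

  0<+ : ∀ {x y} → 0# < x → 0# < y → 0# < x + y
  0<+ 0<x 0<y = <-≤-trans 0<x (x≤x+y (proj₁ 0<y))

  *-inverseˡ : ∀ {x} → 0# < x → x ⁻¹ * x ≡ 1#
  *-inverseˡ {x} (_ , 0≢x) = trans (*-comm (x ⁻¹) x) (*-inverseʳ x (0≢x ∘ sym))

  ⁻¹-nonNegative : ∀ {x} → 0# < x → 0# ≤ x ⁻¹
  ⁻¹-nonNegative {x} 0<x = subst (0# ≤_) eq (*-nonNegative (proj₁ 0<x) (0≤x*x (x ⁻¹)))
    where
    eq : x * (x ⁻¹ * x ⁻¹) ≡ x ⁻¹
    eq = trans (solve 2 (λ x y → x :* (y :* y) := (y :* x) :* y) refl x (x ⁻¹))
           (trans (cong (_* x ⁻¹) (*-inverseˡ 0<x)) (*-identityˡ (x ⁻¹)))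

  *-cancelˡ-≤ : ∀ {z x y} → 0# < z → z * x ≤ z * y → x ≤ y
  *-cancelˡ-≤ {z} {x} {y} 0<z p = subst₂ _≤_ (lem x) (lem y) (*-monoʳ-≤ (⁻¹-nonNegative 0<z) p)
    where
    lem : ∀ t → z ⁻¹ * (z * t) ≡ t
    lem t = trans (sym (*-assoc _ z t)) (trans (cong (_* t) (*-inverseˡ 0<z)) (*-identityˡ t))

  0<* : ∀ {x y} → 0# < x → 0# < y → 0# < x * y
  0<* {x} {y} 0<x 0<y = *-nonNegative (proj₁ 0<x) (proj₁ 0<y) , λ 0≡xy →
    <⇒≱ 0<y (*-cancelˡ-≤ 0<x (≤-reflexive (trans (sym 0≡xy) (sym (zeroʳ x)))))

  /-*-cancel : ∀ {x} → 0# < x → ∀ y → y / x * x ≡ y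
  /-*-cancel {x} 0<x y = trans (*-assoc y (x ⁻¹) x)
    (trans (cong (y *_) (*-inverseˡ 0<x)) (*-identityʳ y))

  ⁻¹-antimono-≤ : ∀ {x y} → 0# < x → x ≤ y → y ⁻¹ ≤ x ⁻¹
  ⁻¹-antimono-≤ {x} {y} 0<x x≤y = *-cancelˡ-≤ (0<* 0<x 0<y) (subst₂ _≤_
    (trans (sym (trans (cong (x *_) (*-inverseˡ 0<y)) (*-identityʳ x)))
      (solve 3 (λ x y z → x :* (z :* y) := x :* y :* z) refl x y (y ⁻¹)))
    (trans (sym (trans (cong (y *_) (*-inverseˡ 0<x)) (*-identityʳ y)))
      (solve 3 (λ x y z → y :* (z :* x) := x :* y :* z) refl x y (x ⁻¹)))
    x≤y)
    where
    0<y = <-≤-trans 0<x x≤y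

  ½ : ℝ
  ½ = (1# + 1#) ⁻¹

  ½+½≡1 : ½ + ½ ≡ 1#
  ½+½≡1 = trans (solve 1 (λ h → h :+ h := h :* (con 1 :+ con 1)) refl ½) (*-inverseˡ (0<+ 0<1 0<1))

  0<½ : 0# < ½
  0<½ = ⁻¹-nonNegative (0<+ 0<1 0<1) , λ 0≡½ →
    0≢1 (trans (sym (+-identityˡ 0#)) (trans (cong₂ _+_ 0≡½ 0≡½) ½+½≡1))

  ·-zero : ∀ k → k · 0# ≡ 0#
  ·-zero zero    = refl
  ·-zero (suc k) = trans (+-identityˡ _) (·-zero k)

  ·-nonNegative : ∀ k {x} → 0# ≤ x → 0# ≤ k · x
  ·-nonNegative zero    0≤x = ≤-refl
  ·-nonNegative (suc k) 0≤x = 0≤+ 0≤x (·-nonNegative k 0≤x)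

  ·-monoˡ-≤ : ∀ {k l x} → 0# ≤ x → k ℕ.≤ l → k · x ≤ l · x
  ·-monoˡ-≤ {l = l} 0≤x ℕ.z≤n       = ·-nonNegative l 0≤x
  ·-monoˡ-≤         0≤x (ℕ.s≤s k≤l) = +-monoʳ-≤ _ (·-monoˡ-≤ 0≤x k≤l)

  sum-mono-≤ : ∀ {n} {f g : Fin n → ℝ} → (∀ i → f i ≤ g i) → sum f ≤ sum g
  sum-mono-≤ {zero}  f≤g = ≤-refl
  sum-mono-≤ {suc n} f≤g = +-mono-≤ (f≤g zero) (sum-mono-≤ (f≤g ∘ suc))

  sum-zero : ∀ {n} {f : Fin n → ℝ} → (∀ i → f i ≡ 0#) → sum f ≡ 0#
  sum-zero {n} f≡0 = trans (sum-cong-≗ f≡0) (sum-replicate-zero n)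

  sum-nonNegative : ∀ {n} {f : Fin n → ℝ} → (∀ i → 0# ≤ f i) → 0# ≤ sum f
  sum-nonNegative {n} {f} 0≤f = subst (_≤ sum f) (sum-replicate-zero n) (sum-mono-≤ 0≤f)

  term≤sum : ∀ {n} {f : Fin n → ℝ} → (∀ i → 0# ≤ f i) → ∀ i → f i ≤ sum f
  term≤sum {suc n} {f} 0≤f i =
    ≤-trans (x≤x+y (sum-nonNegative (0≤f ∘ punchIn i))) (≤-reflexive (sym (sum-remove f)))

  two-terms≤sum : ∀ {n} {f : Fin n → ℝ} → (∀ i → 0# ≤ f i) →
                  ∀ {i j} → i ≢ j → f i + f j ≤ sum f
  two-terms≤sum {suc n} {f} 0≤f {i} {j} i≢j =
    ≤-trans (+-monoʳ-≤ (f i) (subst (λ k → f k ≤ _) (punchIn-punchOut i≢j)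
        (term≤sum (0≤f ∘ punchIn i) (punchOut i≢j))))
      (≤-reflexive (sym (sum-remove f)))

  sum-differ-at : ∀ {n} {f g : Fin n → ℝ} i → (∀ j → j ≢ i → f j ≡ g j) →
                  sum f + g i ≡ f i + sum g
  sum-differ-at {suc n} {f} {g} i f≗g = begin
    sum f + g i                      ≡⟨ cong (_+ g i) (sum-remove f) ⟩
    f i + sum (f ∘ punchIn i) + g i  ≡⟨ +-assoc _ _ _ ⟩
    f i + (sum (f ∘ punchIn i) + g i)
      ≡⟨ cong (λ s → f i + (s + g i)) (sum-cong-≗ λ j → f≗g (punchIn i j) (punchInᵢ≢i i j)) ⟩
    f i + (sum (g ∘ punchIn i) + g i) ≡⟨ cong (f i +_) (+-comm _ (g i)) ⟩
    f i + (g i + sum (g ∘ punchIn i)) ≡⟨ cong (f i +_) (sum-remove g) ⟨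
    f i + sum g                      ∎
    where open ≡-Reasoning

  sum-extra : ∀ {n} {f g : Fin n → ℝ} i → g i ≡ 0# → (∀ j → j ≢ i → f j ≡ g j) →
              sum f ≡ f i + sum g
  sum-extra i gi≡0 f≗g =
    trans (sym (trans (cong (_ +_) gi≡0) (+-identityʳ _))) (sum-differ-at i f≗g)

  sum-single : ∀ {n} {f : Fin n → ℝ} i → (∀ j → j ≢ i → f j ≡ 0#) → sum f ≡ f i
  sum-single {n} {f} i f≡0 =
    trans (sum-extra {g = λ _ → 0#} i refl f≡0)
      (trans (cong (f i +_) (sum-replicate-zero n)) (+-identityʳ (f i)))

does-true : ∀ {P : Set} (P? : Dec P) → does P? ≡ true → P
does-true (yes p) _ = p

does-false : ∀ {P : Set} (P? : Dec P) → does P? ≡ false → ¬ P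
does-false (no ¬p) _ = ¬p

least : {P : ℕ → Set} → (∀ k → Dec (P k)) → ∀ {k} → P k →
        ∃[ m ] P m × (∀ {j} → P j → m ℕ.≤ j)
least P? {zero}  p = zero , p , λ _ → z≤n
least P? {suc k} p with P? zero
... | yes p₀ = zero , p₀ , λ _ → z≤n
... | no ¬p₀ with m , pₘ , min ← least (P? ∘ suc) p =
  suc m , pₘ , λ { {zero} p₀ → contradiction p₀ ¬p₀ ; {suc j} pⱼ → s≤s (min pⱼ) }

-- Simple paths, distances, and bridges of trees.

module _ {n : ℕ} {A : Rel (Fin n) 0ℓ} where

  -- Simple paths, with the list of the vertices after the first one.
  data Path : Fin n → List (Fin n) → Fin n → Set where
    []  : ∀ {u} → Path u [] u
    _∷_ : ∀ {u z zs v} → A u z × All (u ≢_) (z ∷ zs) → Path z zs v → Path u (z ∷ zs) v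

  path-unique : ∀ {u zs v} → Path u zs v → Unique (u ∷ zs)
  path-unique []               = [] ∷ []
  path-unique ((_ , u∉) ∷ p) = u∉ ∷ path-unique p

  path-all : ∀ {P : Fin n → Set} → (∀ {u z} → A u z → P z) →
             ∀ {u zs v} → P u → Path u zs v → All P (u ∷ zs)
  path-all next pu []             = pu ∷ []
  path-all next pu ((a , _) ∷ p) = pu ∷ path-all next (next a) p

  path-suffix : ∀ {z zs v u} → Path z zs v → u ∈ z ∷ zs → ∃[ us ] Path u us v
  path-suffix p       (here refl) = _ , p
  path-suffix (_ ∷ p) (there u∈)  = path-suffix p u∈

  -- Loop erasure: if the new first vertex already lies on the path, only the part of the path from
  -- there on is kept.
  star⇒path : ∀ {u v} → Star A u v → ∃[ zs ] Path u zs v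
  star⇒path ε = [] , []
  star⇒path {u} (a ◅ as) with zs , p ← star⇒path as with Any.any? (u ≟_) (_ ∷ zs)
  ... | yes u∈ = path-suffix p u∈
  ... | no u∉  = _ , (a , ¬Any⇒All¬ _ u∉) ∷ p

  path-++ : ∀ {B : Rel (Fin n) 0ℓ} → (∀ {u z} → A u z → B u z) →
            ∀ {u zs v vs} → Path u zs v → Linked B (v ∷ vs) → Linked B (u ∷ zs ++ vs)
  path-++ A⇒B []            l = l
  path-++ A⇒B ((a , _) ∷ p) l = A⇒B a ∷ path-++ A⇒B p l

module _ {n : ℕ} (G : Graph n) where
  open Graph G

  -- An edge that is a bridge, witnessed by one side of the cut.
  record Bridge (x y : Fin n) : Set where
    field
      side    : Fin n → Bool
      side-x  : side x ≡ true
      side-y  : side y ≡ false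
      unique  : ∀ {p q} → p ~ q → side p ≡ true → side q ≡ false → p ≡ x × q ≡ y

    same-side : ∀ {p q} → p ~ q → ¬ (p ≡ x × q ≡ y) → ¬ (q ≡ x × p ≡ y) → side p ≡ side q
    same-side {p} {q} p~q ¬xy ¬yx with side p in sp | side q in sq
    ... | true  | true  = refl
    ... | false | false = refl
    ... | true  | false = contradiction (unique p~q sp sq) ¬xy
    ... | false | true  = contradiction (unique (~-sym p~q) sq sp) ¬yx

  Bridged : Set
  Bridged = ∀ {x y} → x ~ y → Bridge x y

  walk? : ∀ k x y → Dec (Walk G k x y)
  walk? zero    x y = map′ (λ { refl → [] }) (λ { [] → refl }) (x ≟ y)
  walk? (suc k) x y = map′ (λ { (_ , e , w) → e ∷ w }) (λ { (e ∷ w) → _ , e , w })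
    (any? λ z → (x ~? z) ×-dec walk? k z y)

  -- Walks of a fixed length are decidable by trying all second vertices, so a least length can be
  -- found by search below any known one.
  distance : (∀ x y → ∃[ k ] Walk G k x y) → ∃ (IsDistance G)
  distance walks = (λ x y → proj₁ (shortest x y)) , λ x y → proj₂ (shortest x y)
    where
    shortest : ∀ x y → ∃[ k ] Walk G k x y × (∀ {j} → Walk G j x y → k ℕ.≤ j)
    shortest x y = least (λ k → walk? k x y) (proj₂ (walks x y))

  module Distance {d : Fin n → Fin n → ℕ} (isDistance : IsDistance G d) where

    d-walk : ∀ {k x y} → Walk G k x y → d x y ℕ.≤ k
    d-walk = proj₂ (isDistance _ _)

    d-refl : ∀ x → d x x ≡ 0
    d-refl x = ℕ.n≤0⇒n≡0 (d-walk [])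

    d-step : ∀ {x y} z → x ~ y → d x z ℕ.≤ suc (d y z)
    d-step z x~y = d-walk (x~y ∷ proj₁ (isDistance _ z))

    0<d : ∀ {x y} → x ≢ y → 0 ℕ.< d x y
    0<d {x} {y} x≢y with d x y | proj₁ (isDistance x y)
    ... | zero  | [] = contradiction refl x≢y
    ... | suc _ | _  = s≤s z≤n

  -- Deleting an edge xy of a tree leaves the vertices closer to x and
  -- those closer to y: within each part geodesics lead to x resp. y, so a
  -- second edge between the parts would close a cycle.
  tree-bridged : IsTree G → Bridged
  tree-bridged ((_ , walks) , acyclic) {x} {y} x~y = record
    { side = side ; side-x = side-x ; side-y = side-y ; unique = unique }
    where
    d = proj₁ (distance walks)
    isDistance = proj₂ (distance walks)
    open Distance isDistance

    closer? : ∀ u → Dec (d u x ℕ.< d u y)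
    closer? u = d u x ℕ.<? d u y

    side : Fin n → Bool
    side u = does (closer? u)

    x≢y : x ≢ y
    x≢y x≡y = ~-irrefl x≡y x~y

    side-x : side x ≡ true
    side-x = dec-true (closer? x) (subst (ℕ._< d x y) (sym (d-refl x)) (0<d x≢y))

    side-y : side y ≡ false
    side-y = dec-false (closer? y) λ lt → ℕ.n≮0 (subst (d y x ℕ.<_) (d-refl y) lt)

    Within : Bool → Rel (Fin n) 0ℓ
    Within s u z = u ~ z × side u ≡ s × side z ≡ s

    within-sym : ∀ {s u z} → Within s u z → Within s z u
    within-sym (e , su , sz) = ~-sym e , sz , su

    -- The inequality is an invariant of following the walk: a step shortens the remaining walk by
    -- one and lowers the distance to `y` by at most one. Since `k` bounds the distance to `x`, it
    -- keeps each vertex on the side of `x`. Ties count for `y`, whence the non-strict version in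
    -- `geodesic-y`.
    geodesic-x : ∀ {k u} → Walk G k u x → k ℕ.< d u y → Star (Within true) u x
    geodesic-x []                     _  = ε
    geodesic-x {u = u} (_∷_ {y = z} e w) lt =
      (e , dec-true (closer? u) (ℕ.≤-<-trans (d-walk (e ∷ w)) lt)
         , dec-true (closer? z) (ℕ.≤-<-trans (d-walk w) lt′))
      ◅ geodesic-x w lt′
      where lt′ = ℕ.≤-pred (ℕ.≤-trans lt (d-step y e))

    geodesic-y : ∀ {k u} → Walk G k u y → k ℕ.≤ d u x → Star (Within false) u y
    geodesic-y []                     _  = ε
    geodesic-y {u = u} (_∷_ {y = z} e w) le =
      (e , dec-false (closer? u) (ℕ.≤⇒≯ (ℕ.≤-trans (d-walk (e ∷ w)) le))
         , dec-false (closer? z) (ℕ.≤⇒≯ (ℕ.≤-trans (d-walk w) le′)))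
      ◅ geodesic-y w le′
      where le′ = ℕ.≤-pred (ℕ.≤-trans le (d-step x e))

    unique : ∀ {p q} → p ~ q → side p ≡ true → side q ≡ false → p ≡ x × q ≡ y
    unique {p} {q} p~q sp sq = close (proj₂ (star⇒path p⇝x)) (proj₂ (star⇒path y⇝q))
      where
      p⇝x : Star (Within true) p x
      p⇝x = geodesic-x (proj₁ (isDistance p x)) (does-true (closer? p) sp)

      y⇝q : Star (Within false) y q
      y⇝q = reverse within-sym (geodesic-y (proj₁ (isDistance q y)) (ℕ.≮⇒≥ (does-false (closer? q) sq)))

      module _ {as bs : List (Fin n)} (α : Path {A = Within true} p as x)
               (β : Path {A = Within false} y bs q) where

        cycle-unique : Unique (p ∷ as ++ y ∷ bs)
        cycle-unique = ++⁺ (path-unique α) (path-unique β) disjoint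
          where
          disjoint : Disjoint (p ∷ as) (y ∷ bs)
          disjoint (u∈as , u∈bs) with () ← trans
            (sym (All.lookup (path-all {P = λ u → side u ≡ true} (λ (_ , _ , sz) → sz) sp α) u∈as))
            (All.lookup (path-all {P = λ u → side u ≡ false} (λ (_ , _ , sz) → sz) side-y β) u∈bs)

        cycle-linked : Linked _~_ (p ∷ (as ++ y ∷ bs) ++ p ∷ [])
        cycle-linked = subst (λ l → Linked _~_ (p ∷ l)) (sym (++-assoc as (y ∷ bs) (p ∷ [])))
          (path-++ edge α (x~y ∷ path-++ edge β (~-sym p~q ∷ [-])))
          where
          edge : ∀ {s u z} → Within s u z → u ~ z
          edge (e , _) = e

      close : ∀ {as bs} → Path p as x → Path y bs q → p ≡ x × q ≡ y
      -- If both paths are trivial, the crossing edge is `x y` itself. Otherwise the concatenation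
      -- has at least three vertices and is a forbidden cycle.
      close [] [] = refl , refl
      close [] β@(_ ∷ _) =
        ⊥-elim (acyclic _ _ (s≤s (s≤s (s≤s z≤n)) , cycle-unique [] β , cycle-linked [] β))
      close {as = _ ∷ as} α@(_ ∷ _) β = ⊥-elim (acyclic _ _
        (s≤s (s≤s (subst (1 ℕ.≤_) (sym (length-++ as)) (ℕ.m≤n⇒m≤o+n (length as) (s≤s z≤n))))
        , cycle-unique α β , cycle-linked α β))

-- Suppression of one vertex: connectedness and bridges survive.

-- H arises from G by suppressing v, whose neighbours are x and y; unlike
-- for suppress, the roles of x and y may be exchanged.
record Suppresses {n : ℕ} (G : Graph (suc n)) (v x y : Fin (suc n)) (H : Graph n) : Set where
  open Graph G
  open Graph H using () renaming (_~_ to _~ᴴ_)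
  field
    x≢y        : x ≢ y
    v~x        : v ~ x
    v~y        : v ~ y
    neighbours : ∀ {z} → v ~ z → z ≡ x ⊎ z ≡ y
    old        : ∀ {a b} → punchIn v a ~ punchIn v b → a ~ᴴ b
    new        : ∀ {a b} → punchIn v a ≡ x → punchIn v b ≡ y → a ~ᴴ b
    edges      : ∀ {a b} → a ~ᴴ b → punchIn v a ~ punchIn v b ⊎
                 (punchIn v a ≡ x × punchIn v b ≡ y ⊎ punchIn v a ≡ y × punchIn v b ≡ x)

  v≢x : v ≢ x
  v≢x v≡x = ~-irrefl v≡x v~x

  v≢y : v ≢ y
  v≢y v≡y = ~-irrefl v≡y v~y

swap-ends : ∀ {n} {G : Graph (suc n)} {v x y} {H : Graph n} →
            Suppresses G v x y H → Suppresses G v y x H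
swap-ends {H = H} S = record
  { x≢y = x≢y ∘ sym ; v~x = v~y ; v~y = v~x ; neighbours = ⊎.swap ∘ neighbours
  ; old = old ; new = λ a≡y b≡x → Graph.~-sym H (new b≡x a≡y) ; edges = ⊎.map₂ ⊎.swap ∘ edges }
  where open Suppresses S

one-of-two : ∀ {A : Set} {xs : List A} {x y z} → length xs ≡ 2 → x ≢ y →
             x ∈ xs → y ∈ xs → z ∈ xs → z ≡ x ⊎ z ≡ y
one-of-two {xs = _ ∷ _ ∷ []} _ x≢y (here refl)         (here refl)         _ = contradiction refl x≢y
one-of-two {xs = _ ∷ _ ∷ []} _ x≢y (there (here refl)) (there (here refl)) _ = contradiction refl x≢y
one-of-two {xs = _ ∷ _ ∷ []} _ _ (here refl)         (there (here refl)) (here refl)         = inj₁ refl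
one-of-two {xs = _ ∷ _ ∷ []} _ _ (here refl)         (there (here refl)) (there (here refl)) = inj₂ refl
one-of-two {xs = _ ∷ _ ∷ []} _ _ (there (here refl)) (here refl)         (here refl)         = inj₂ refl
one-of-two {xs = _ ∷ _ ∷ []} _ _ (there (here refl)) (here refl)         (there (here refl)) = inj₁ refl

degree-2-neighbours : ∀ {n} (G : Graph n) (let open Graph G) {v x y} → degree G v ≡ 2 →
                      x ≢ y → v ~ x → v ~ y → ∀ {z} → v ~ z → z ≡ x ⊎ z ≡ y
degree-2-neighbours G {v} deg x≢y v~x v~y v~z =
  one-of-two deg x≢y (listed v~x) (listed v~y) (listed v~z)
  where
  open Graph G
  listed : ∀ {z} → v ~ z → z ∈ filter (v ~?_) (allFin _)
  listed = ∈-filter⁺ (v ~?_) (∈-allFin _)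

suppress-suppresses : ∀ {n} (G : Graph (suc n)) (let open Graph G) {v x y} (x≢y : x ≢ y) →
                      degree G v ≡ 2 → v ~ x → v ~ y →
                      Suppresses G v x y (suppress G v x y x≢y)
suppress-suppresses G x≢y deg v~x v~y = record
  { x≢y = x≢y ; v~x = v~x ; v~y = v~y
  ; neighbours = degree-2-neighbours G deg x≢y v~x v~y
  ; old = inj₁ ; new = λ a≡x b≡y → inj₂ (inj₁ (a≡x , b≡y))
  ; edges = ⊎.map₂ (⊎.map₂ λ (b≡x , a≡y) → a≡y , b≡x) }

module _ {n : ℕ} {G : Graph (suc n)} {H : Graph n} where
  open Graph G
  open Graph H using () renaming (_~_ to _~ᴴ_; ~-sym to ~ᴴ-sym)

  suppress-hasEdge : ∀ {v x y} → Suppresses G v x y H → HasEdge H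
  suppress-hasEdge S = _ , _ , new (punchIn-punchOut v≢x) (punchIn-punchOut v≢y)
    where open Suppresses S

  -- Sending `v` to `x` and fixing all other vertices maps each edge of `G` to an edge of `H` or to
  -- a single vertex, so walks can be pushed forward.
  suppress-connected : ∀ {v x y} → Suppresses G v x y H → (∀ p q → ∃[ k ] Walk G k p q) →
                       ∀ a b → ∃[ k ] Walk H k a b
  suppress-connected {v} {x} {y} S walks a b =
    subst₂ (λ a b → ∃[ k ] Walk H k a b) (retract-punchIn a) (retract-punchIn b)
      (retract-walk (proj₂ (walks (punchIn v a) (punchIn v b))))
    where
    open Suppresses S

    retract : Fin (suc n) → Fin n
    retract p with v ≟ p
    ... | yes _  = punchOut v≢x
    ... | no v≢p = punchOut v≢p

    punchIn-retract : ∀ {p} → v ≢ p → punchIn v (retract p) ≡ p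
    punchIn-retract {p} v≢p with v ≟ p
    ... | yes v≡p = contradiction v≡p v≢p
    ... | no v≢p′ = punchIn-punchOut v≢p′

    punchIn-retract-v : punchIn v (retract v) ≡ x
    punchIn-retract-v with v ≟ v
    ... | yes _  = punchIn-punchOut v≢x
    ... | no v≢v = contradiction refl v≢v

    retract-punchIn : ∀ a → retract (punchIn v a) ≡ a
    retract-punchIn a = punchIn-injective v _ _ (punchIn-retract (punchInᵢ≢i v a ∘ sym))

    from-v : ∀ {q} → v ~ q → retract v ≡ retract q ⊎ retract v ~ᴴ retract q
    from-v v~q with neighbours v~q
    ... | inj₁ refl = inj₁ (punchIn-injective v _ _
                        (trans punchIn-retract-v (sym (punchIn-retract v≢x))))
    ... | inj₂ refl = inj₂ (new punchIn-retract-v (punchIn-retract v≢y))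

    retract-edge : ∀ {p q} → p ~ q → retract p ≡ retract q ⊎ retract p ~ᴴ retract q
    retract-edge {p} {q} p~q = edge (v ≟ p) (v ≟ q)
      where
      edge : Dec (v ≡ p) → Dec (v ≡ q) → retract p ≡ retract q ⊎ retract p ~ᴴ retract q
      edge (yes refl) _          = from-v p~q
      edge (no _)     (yes refl) = ⊎.map sym ~ᴴ-sym (from-v (~-sym p~q))
      edge (no v≢p)   (no v≢q)   = inj₂ (old
        (subst₂ _~_ (sym (punchIn-retract v≢p)) (sym (punchIn-retract v≢q)) p~q))

    retract-walk : ∀ {k p q} → Walk G k p q → ∃[ l ] Walk H l (retract p) (retract q)
    retract-walk []      = _ , []
    retract-walk (e ∷ w) with retract-edge e | retract-walk w
    ... | inj₁ eq | l , w′ = l , subst (λ p → Walk H l p _) (sym eq) w′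
    ... | inj₂ e′ | l , w′ = suc l , e′ ∷ w′

  -- The cut is taken at the edge `x v`: the inherited `side-y` is the value at `v`, and `y-side`
  -- the one at `y`. These agree because `v y` would otherwise be a second crossing edge.
  module Cut {v x y : Fin (suc n)} (S : Suppresses G v x y H) (bridged : Bridged G) where
    open Suppresses S
    open Bridge (bridged (~-sym v~x)) public

    y-side : side y ≡ false
    y-side with side y in eq
    ... | false = refl
    ... | true  = contradiction (sym (proj₁ (unique (~-sym v~y) eq side-y))) x≢y

    -- It would be a second edge across the cut. Hence the new edge never coincides with an old one,
    -- and the weighted degree at `x` trades exactly the term of `v` for that of `y`.
    x≁y : ¬ x ~ y
    x≁y x~y = v≢y (sym (proj₂ (unique x~y side-x y-side)))

    old-same-side : ∀ {a b} → punchIn v a ~ punchIn v b → side (punchIn v a) ≡ side (punchIn v b)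
    old-same-side {a} {b} e = same-side e
      (λ (_ , b≡v) → punchInᵢ≢i v b b≡v) (λ (_ , a≡v) → punchInᵢ≢i v a a≡v)

    new-bridge : ∀ {a b} → punchIn v a ≡ x → punchIn v b ≡ y → Bridge H a b
    new-bridge {a} {b} a≡x b≡y = record
      { side = side ∘ punchIn v ; side-x = trans (cong side a≡x) side-x
      ; side-y = trans (cong side b≡y) y-side ; unique = unique′ }
      where
      unique′ : ∀ {p q} → p ~ᴴ q → side (punchIn v p) ≡ true → side (punchIn v q) ≡ false →
                p ≡ a × q ≡ b
      unique′ e sp sq with edges e
      ... | inj₁ e′ with () ← trans (sym sp) (trans (old-same-side e′) sq)
      ... | inj₂ (inj₁ (p≡x , q≡y)) =
        punchIn-injective v _ _ (trans p≡x (sym a≡x)) , punchIn-injective v _ _ (trans q≡y (sym b≡y))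
      ... | inj₂ (inj₂ (p≡y , _)) with () ← trans (sym sp) (trans (cong side p≡y) y-side)

  suppress-bridged : ∀ {v x y} → Suppresses G v x y H → Bridged G → Bridged H
  suppress-bridged {v} S bridged {a} {b} a~b with Suppresses.edges S a~b
  ... | inj₂ (inj₁ (a≡x , b≡y)) = Cut.new-bridge S bridged a≡x b≡y
  ... | inj₂ (inj₂ (a≡y , b≡x)) = Cut.new-bridge (swap-ends S) bridged a≡y b≡x
  ... | inj₁ a~b′ = record
    { side = side ∘ punchIn v ; side-x = side-x ; side-y = side-y ; unique = unique′ }
    where
    open Bridge (bridged a~b′)

    -- A path `s v t` between the two sides would contain the only crossing edge, but both ends of
    -- that edge are in the image of `punchIn v` and so differ from `v`.
    through-v : ∀ {s t} → v ~ s → v ~ t → side s ≡ true → ¬ side t ≡ false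
    through-v v~s v~t ss st with side v in sv
    ... | true  = punchInᵢ≢i v a (sym (proj₁ (unique v~t sv st)))
    ... | false = punchInᵢ≢i v b (sym (proj₂ (unique (~-sym v~s) ss sv)))

    unique′ : ∀ {p q} → p ~ᴴ q → side (punchIn v p) ≡ true → side (punchIn v q) ≡ false →
              p ≡ a × q ≡ b
    unique′ e sp sq with Suppresses.edges S e
    ... | inj₁ e′ with p≡a , q≡b ← unique e′ sp sq =
      punchIn-injective v _ _ p≡a , punchIn-injective v _ _ q≡b
    ... | inj₂ (inj₁ (refl , refl)) = contradiction sq (through-v (Suppresses.v~x S) (Suppresses.v~y S) sp)
    ... | inj₂ (inj₂ (refl , refl)) = contradiction sq (through-v (Suppresses.v~y S) (Suppresses.v~x S) sp)

-- Kantorovich potentials for the balls at the two ends of a bridge.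

δ : ∀ {n} → Fin n → Fin n → ℕ
δ i u = if does (u ≟ i) then 1 else 0

δ≤1 : ∀ {n} (i u : Fin n) → δ i u ℕ.≤ 1
δ≤1 i u with u ≟ i
... | yes _ = s≤s z≤n
... | no _  = z≤n

δ-diag : ∀ {n} (i : Fin n) → δ i i ≡ 1
δ-diag i = if-yes (i ≟ i) refl

δ-off : ∀ {n} {i u : Fin n} → u ≢ i → δ i u ≡ 0
δ-off {i = i} {u} = if-no (u ≟ i)

-- For distinct `i` and `j` the values are 1 at `i`, 2 at `j` and 0 elsewhere. On the two balls,
-- `3 - pot x y` and `pot y x` are then the level function 3, 2, 1, 0 along a path u, x, y, v across
-- the bridge.
pot : ∀ {n} → Fin n → Fin n → Fin n → ℕ
pot i j u = δ i u ℕ.+ (δ j u ℕ.+ δ j u)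

pot-1 : ∀ {n} {i j : Fin n} → i ≢ j → pot i j i ≡ 1
pot-1 {i = i} i≢j = cong₂ ℕ._+_ (δ-diag i) (cong (λ k → k ℕ.+ k) (δ-off i≢j))

pot-2 : ∀ {n} {i j : Fin n} → i ≢ j → pot i j j ≡ 2
pot-2 {j = j} i≢j = cong₂ ℕ._+_ (δ-off (i≢j ∘ sym)) (cong (λ k → k ℕ.+ k) (δ-diag j))

pot-0 : ∀ {n} {i j u : Fin n} → u ≢ i → u ≢ j → pot i j u ≡ 0
pot-0 u≢i u≢j = cong₂ ℕ._+_ (δ-off u≢i) (cong (λ k → k ℕ.+ k) (δ-off u≢j))

module _ {n : ℕ} (G : Graph n) where
  open Graph G

  Near : Fin n → Fin n → Set
  Near x u = u ≡ x ⊎ x ~ u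

  walk-δ : ∀ {k u v} → Walk G k u v → 1 ℕ.≤ k ℕ.+ δ u v
  walk-δ {u = u} []      = ℕ.≤-reflexive (sym (δ-diag u))
  walk-δ (_ ∷ _) = s≤s z≤n

  walk-δ′ : ∀ {k u v} → Walk G k u v → 1 ℕ.≤ k ℕ.+ δ v u
  walk-δ′ {u = u} []      = ℕ.≤-reflexive (sym (δ-diag u))
  walk-δ′ (_ ∷ _) = s≤s z≤n

  -- Kantorovich duality between the balls around x and y, for the potentials
  -- 3 - pot x y and pot y x; load moves them to the side of the distance.
  module Duality {x y : Fin n} (x~y : x ~ y) (bridge : Bridge G x y)
                 {d : Fin n → Fin n → ℕ} (isDistance : IsDistance G d) where
    open Bridge bridge
    open Distance G isDistance

    x≢y : x ≢ y
    x≢y x≡y = ~-irrefl x≡y x~y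

    load : Fin n → Fin n → ℕ
    load u v = d u v ℕ.+ (pot x y u ℕ.+ pot y x v)

    -- The bridge costs one step, a start other than `x` another one before it, and an end other
    -- than `y` another one after it. In the recursion, a step that stays on the side of `x` pays
    -- for the indicator at the next vertex.
    walk-across : ∀ {k u v} → Walk G k u v → side u ≡ true → side v ≡ false →
                  3 ℕ.≤ k ℕ.+ (δ x u ℕ.+ δ y v)
    walk-across [] su sv with () ← trans (sym su) sv
    walk-across {suc k} {u} {v} (_∷_ {y = z} e w) su sv with side z in sz
    ... | true = ℕ.≤-trans (walk-across w sz sv)
      (ℕ.≤-trans (ℕ.+-monoʳ-≤ k (ℕ.+-monoˡ-≤ (δ y v) (δ≤1 x z)))
      (ℕ.≤-trans (ℕ.≤-reflexive (ℕ.+-suc k (δ y v)))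
                 (ℕ.+-monoʳ-≤ (suc k) (ℕ.m≤n+m (δ y v) (δ x u)))))
    ... | false with refl , refl ← unique e su sz rewrite δ-diag x =
      s≤s (subst (2 ℕ.≤_) (sym (ℕ.+-suc k (δ y v))) (s≤s (walk-δ w)))

    near-x-side : ∀ {u} → Near x u → u ≢ y → side u ≡ true
    near-x-side (inj₁ refl) _   = side-x
    near-x-side (inj₂ x~u)  u≢y =
      trans (sym (same-side x~u (u≢y ∘ proj₂) (x≢y ∘ proj₂))) side-x

    near-y-side : ∀ {v} → Near y v → v ≢ x → side v ≡ false
    near-y-side (inj₁ refl) _   = side-y
    near-y-side (inj₂ y~v)  v≢x =
      trans (sym (same-side y~v (x≢y ∘ sym ∘ proj₁) (v≢x ∘ proj₁))) side-y

    -- The ball of `x` lies on the side of `x` except for `y`, and that of `y` on the other side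
    -- except for `x`. At an exceptional vertex its potential already contributes 2, and the missing
    -- 1 is a positive distance or an indicator.
    dual-feasible : ∀ {u v} → Near x u → Near y v → 3 ℕ.≤ load u v
    dual-feasible {u} {v} nu nv = by-cases (u ≟ y) (v ≟ x)
      where
      by-cases : Dec (u ≡ y) → Dec (v ≡ x) → 3 ℕ.≤ load u v
      by-cases (yes refl) _ = subst (3 ℕ.≤_)
        (solve 3 (λ a b c → a :+ (b :+ c) := b :+ (a :+ c)) refl (pot x y y) (d y v) (pot y x v))
        (ℕ.+-mono-≤ (ℕ.≤-reflexive (sym (pot-2 x≢y)))
          (ℕ.≤-trans (walk-δ (proj₁ (isDistance y v))) (ℕ.+-monoʳ-≤ (d y v) (ℕ.m≤m+n _ _))))
        where open ℕ.+-*-Solver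
      by-cases (no _) (yes refl) = subst (3 ℕ.≤_)
        (solve 3 (λ a b c → a :+ (b :+ c) := b :+ (c :+ a)) refl (pot y x x) (d u x) (pot x y u))
        (ℕ.+-mono-≤ (ℕ.≤-reflexive (sym (pot-2 (x≢y ∘ sym))))
          (ℕ.≤-trans (walk-δ′ (proj₁ (isDistance u x))) (ℕ.+-monoʳ-≤ (d u x) (ℕ.m≤m+n _ _))))
        where open ℕ.+-*-Solver
      by-cases (no u≢y) (no v≢x) = ℕ.≤-trans
        (walk-across (proj₁ (isDistance u v)) (near-x-side nu u≢y) (near-y-side nv v≢x))
        (ℕ.+-monoʳ-≤ (d u v) (ℕ.+-mono-≤ (ℕ.m≤m+n (δ x u) _) (ℕ.m≤m+n (δ y v) _)))

    tight-xy : load x y ℕ.≤ 3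
    tight-xy rewrite pot-1 x≢y | pot-1 (x≢y ∘ sym) =
      ℕ.+-monoˡ-≤ 2 (d-walk (x~y ∷ []))

    tight-row : ∀ {v} → Near y v → v ≢ y → load x v ℕ.≤ 3
    tight-row     (inj₁ v≡y) v≢y = contradiction v≡y v≢y
    tight-row {v} (inj₂ y~v) v≢y = by-cases (v ≟ x)
      where
      by-cases : Dec (v ≡ x) → load x v ℕ.≤ 3
      by-cases (yes refl) rewrite pot-1 x≢y | pot-2 (x≢y ∘ sym) | d-refl x = ℕ.≤-refl
      by-cases (no v≢x)   rewrite pot-1 x≢y | pot-0 v≢y v≢x =
        ℕ.+-monoˡ-≤ 1 (d-walk (x~y ∷ y~v ∷ []))

    tight-column : ∀ {u} → Near x u → u ≢ x → load u y ℕ.≤ 3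
    tight-column     (inj₁ u≡x) u≢x = contradiction u≡x u≢x
    tight-column {u} (inj₂ x~u) u≢x = by-cases (u ≟ y)
      where
      by-cases : Dec (u ≡ y) → load u y ℕ.≤ 3
      by-cases (yes refl) rewrite pot-1 (x≢y ∘ sym) | pot-2 x≢y | d-refl y = ℕ.≤-refl
      by-cases (no u≢y)   rewrite pot-1 (x≢y ∘ sym) | pot-0 u≢x u≢y =
        ℕ.+-monoˡ-≤ 1 (d-walk (~-sym x~u ∷ x~y ∷ []))

-- Optimal transport across a bridge.

module Transport (R : CompleteOrderedField) where
  open CompleteOrderedField R
  open OrderedField R
  open Curvature R

  ·-distrib-sum : ∀ {n} k (f : Fin n → ℝ) → sum (λ i → k · f i) ≡ k · sum f
  ·-distrib-sum zero    f = sum-zero {f = λ i → 0 · f i} (λ _ → refl)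
  ·-distrib-sum (suc k) f = trans (∑-distrib-+ f (λ i → k · f i)) (cong (sum f +_) (·-distrib-sum k f))

  ·-at-zero : ∀ k l {t} → t ≡ 0# → k · t ≤ l · t
  ·-at-zero k l refl = ≤-reflexive (trans (·-zero k) (sym (·-zero l)))

  sum-δ : ∀ {n} i (ρ : Fin n → ℝ) → sum (λ u → δ i u · ρ u) ≡ ρ i
  sum-δ i ρ = trans (sum-single i λ u u≢i → cong (_· ρ u) (δ-off u≢i))
    (trans (cong (_· ρ i) (δ-diag i)) (+-identityʳ (ρ i)))

  sum-pot : ∀ {n} i j (ρ : Fin n → ℝ) → sum (λ u → pot i j u · ρ u) ≡ ρ i + (ρ j + ρ j)
  sum-pot i j ρ = begin
    sum (λ u → pot i j u · ρ u)
      ≡⟨ sum-cong-≗ (λ u → trans (×-homo-+ (ρ u) (δ i u) _)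
           (cong (δ i u · ρ u +_) (×-homo-+ (ρ u) (δ j u) _))) ⟩
    sum (λ u → δ i u · ρ u + (δ j u · ρ u + δ j u · ρ u))
      ≡⟨ trans (∑-distrib-+ (λ u → δ i u · ρ u) _)
           (cong (sum (λ u → δ i u · ρ u) +_) (∑-distrib-+ (λ u → δ j u · ρ u) _)) ⟩
    sum (λ u → δ i u · ρ u) + (sum (λ u → δ j u · ρ u) + sum (λ u → δ j u · ρ u))
      ≡⟨ cong₂ (λ s t → s + (t + t)) (sum-δ i ρ) (sum-δ j ρ) ⟩
    ρ i + (ρ j + ρ j) ∎
    where open ≡-Reasoning

  ∑∑-distrib-+ : ∀ {m n} (f g : Fin m → Fin n → ℝ) →
    sum (λ i → sum λ j → f i j + g i j) ≡ sum (λ i → sum (f i)) + sum (λ i → sum (g i))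
  ∑∑-distrib-+ f g = trans (sum-cong-≗ λ i → ∑-distrib-+ (f i) (g i))
    (∑-distrib-+ (λ i → sum (f i)) (λ i → sum (g i)))

  module _ {n : ℕ} (G : Graph n) where
    open Graph G

    module Coupling {ρ σ : Fin n → ℝ} {π : Fin n → Fin n → ℝ}
                    (coupling : IsCoupling G ρ σ π) where
      0≤π = proj₁ coupling
      rows = proj₁ (proj₂ coupling)
      columns = proj₂ (proj₂ coupling)

      π≤row : ∀ u v → π u v ≤ ρ u
      π≤row u v = subst (π u v ≤_) (rows u) (term≤sum (0≤π u) v)

      π≤column : ∀ u v → π u v ≤ σ v
      π≤column u v = subst (π u v ≤_) (columns v) (term≤sum (λ u → 0≤π u v) u)

      ∑∑-marginals : ∀ (g h : Fin n → ℕ) → sum (λ u → sum λ v → (g u ℕ.+ h v) · π u v) ≡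
                     sum (λ u → g u · ρ u) + sum (λ v → h v · σ v)
      ∑∑-marginals g h = begin
        sum (λ u → sum λ v → (g u ℕ.+ h v) · π u v)
          ≡⟨ sum-cong-≗ (λ u → sum-cong-≗ λ v → ×-homo-+ (π u v) (g u) (h v)) ⟩
        sum (λ u → sum λ v → g u · π u v + h v · π u v)
          ≡⟨ ∑∑-distrib-+ (λ u v → g u · π u v) (λ u v → h v · π u v) ⟩
        sum (λ u → sum λ v → g u · π u v) + sum (λ u → sum λ v → h v · π u v)
          ≡⟨ cong (sum (λ u → sum λ v → g u · π u v) +_) (∑-comm (λ u v → h v · π u v)) ⟩
        sum (λ u → sum λ v → g u · π u v) + sum (λ v → sum λ u → h v · π u v)
          ≡⟨ cong₂ _+_
               (sum-cong-≗ λ u → trans (·-distrib-sum (g u) (π u)) (cong (g u ·_) (rows u)))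
               (sum-cong-≗ λ v → trans (·-distrib-sum (h v) (λ u → π u v)) (cong (h v ·_) (columns v))) ⟩
        sum (λ u → g u · ρ u) + sum (λ v → h v · σ v) ∎
        where open ≡-Reasoning

      ∑∑-constant : ∀ k → sum (λ u → sum λ v → k · π u v) ≡ k · sum ρ
      ∑∑-constant k = begin
        sum (λ u → sum λ v → k · π u v) ≡⟨ sum-cong-≗ (λ u → ·-distrib-sum k (π u)) ⟩
        sum (λ u → k · sum (π u))       ≡⟨ ·-distrib-sum k (λ u → sum (π u)) ⟩
        k · sum (λ u → sum (π u))       ≡⟨ cong (k ·_) (sum-cong-≗ rows) ⟩
        k · sum ρ                       ∎
        where open ≡-Reasoning

    module Optimal {x y : Fin n} (x~y : x ~ y) (bridge : Bridge G x y)
                   {d : Fin n → Fin n → ℕ} (isDistance : IsDistance G d)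
                   {ρ σ : Fin n → ℝ}
                   (∑ρ≡1 : sum ρ ≡ 1#) (∑σ≡1 : sum σ ≡ 1#)
                   (supp-ρ : ∀ u → ρ u ≡ 0# ⊎ Near G x u) (supp-σ : ∀ v → σ v ≡ 0# ⊎ Near G y v)
                   where
      open Duality G x~y bridge isDistance

      -- The integrals of `pot x y` against `ρ` and of `pot y x` against `σ`. As the constant 3 is
      -- integrated against total mass one, the dual objective is `3 · 1# - dual`.
      dual : ℝ
      dual = (ρ x + (ρ y + ρ y)) + (σ y + (σ x + σ x))

      cost+dual : ∀ {π} → IsCoupling G ρ σ π →
        cost G d π + dual ≡ sum λ u → sum λ v → load u v · π u v
      cost+dual {π} coupling = sym (begin
        sum (λ u → sum λ v → load u v · π u v)
          ≡⟨ sum-cong-≗ (λ u → sum-cong-≗ λ v → ×-homo-+ (π u v) (d u v) _) ⟩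
        sum (λ u → sum λ v → d u v · π u v + (pot x y u ℕ.+ pot y x v) · π u v)
          ≡⟨ ∑∑-distrib-+ (λ u v → d u v · π u v) _ ⟩
        cost G d π + sum (λ u → sum λ v → (pot x y u ℕ.+ pot y x v) · π u v)
          ≡⟨ cong (cost G d π +_) (trans (∑∑-marginals (pot x y) (pot y x))
               (cong₂ _+_ (sum-pot x y ρ) (sum-pot y x σ))) ⟩
        cost G d π + dual ∎)
        where
        open Coupling coupling
        open ≡-Reasoning

      weak-duality : ∀ {π} → IsCoupling G ρ σ π → 3 · 1# ≤ cost G d π + dual
      weak-duality {π} coupling = subst₂ _≤_
        (trans (∑∑-constant 3) (cong (3 ·_) ∑ρ≡1)) (sym (cost+dual coupling))
        (sum-mono-≤ λ u → sum-mono-≤ λ v → pointwise u v)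
        where
        open Coupling coupling

        pointwise : ∀ u v → 3 · π u v ≤ load u v · π u v
        pointwise u v with supp-ρ u | supp-σ v
        ... | inj₂ nu | inj₂ nv = ·-monoˡ-≤ (0≤π u v) (dual-feasible nu nv)
        ... | inj₁ ρu≡0 | _ = ·-at-zero 3 (load u v) (antisym (subst (π u v ≤_) ρu≡0 (π≤row u v)) (0≤π u v))
        ... | inj₂ _ | inj₁ σv≡0 =
          ·-at-zero 3 (load u v) (antisym (subst (π u v ≤_) σv≡0 (π≤column u v)) (0≤π u v))

      W₁-≥ : ∀ {π} → IsCoupling G ρ σ π → 3 · 1# - dual ≤ cost G d π
      W₁-≥ coupling = +-cancelʳ-≤ dual
        (subst (_≤ cost G d _ + dual) (sym (diff-+ dual (3 · 1#))) (weak-duality coupling))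

      -- The mass of σ outside y comes from x, and that of ρ outside x goes
      -- to y; these are pairs for which dual-feasible is an equality.
      module _ {r : ℝ} (0≤r : 0# ≤ r) (r+1 : r + 1# ≡ ρ x + σ y)
               (0≤ρ : ∀ u → 0# ≤ ρ u) (0≤σ : ∀ v → 0# ≤ σ v) where

        plan : Fin n → Fin n → ℝ
        plan u v = if does (u ≟ x) then (if does (v ≟ y) then r else σ v)
                   else (if does (v ≟ y) then ρ u else 0#)

        plan-by-cases : ∀ (P : Fin n → Fin n → ℝ → Set) → P x y r → (∀ v → v ≢ y → P x v (σ v)) →
                        (∀ u → u ≢ x → P u y (ρ u)) → (∀ u v → u ≢ x → v ≢ y → P u v 0#) →
                        ∀ u v → P u v (plan u v)
        plan-by-cases P pxy px py p u v with u ≟ x | v ≟ y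
        ... | yes refl | yes refl = pxy
        ... | yes refl | no v≢y   = px v v≢y
        ... | no u≢x   | yes refl = py u u≢x
        ... | no u≢x   | no v≢y   = p u v u≢x v≢y

        -- Row `x` of `plan` carries `r` together with all of `σ` outside `y`, that is 1 minus
        -- `σ y`. The prescribed mass `ρ x` thus forces `r` to be `ρ x + σ y` minus 1; column `y`
        -- leads to the same value.
        marginal : ∀ {τ : Fin n → ℝ} {s i} → sum τ ≡ 1# → r + 1# ≡ s + τ i →
                   sum (λ v → if does (v ≟ i) then r else τ v) ≡ s
        marginal {τ} {s} {i} ∑τ≡1 r+1≡ = +-cancelʳ (τ i) _ s
          (trans (sum-differ-at i λ v v≢i → if-no (v ≟ i) v≢i)
            (trans (cong₂ _+_ (if-yes (i ≟ i) refl) ∑τ≡1) r+1≡))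

        plan-row : ∀ u → sum (plan u) ≡ ρ u
        plan-row u with u ≟ x
        ... | yes refl = marginal ∑σ≡1 r+1
        ... | no _ = trans (sum-single y λ v v≢y → if-no (v ≟ y) v≢y) (if-yes (y ≟ y) refl)

        plan-column : ∀ v → sum (λ u → plan u v) ≡ σ v
        plan-column v with v ≟ y
        ... | yes refl = marginal ∑ρ≡1 (trans r+1 (+-comm (ρ x) (σ y)))
        ... | no _ = trans (sum-single x λ u u≢x → if-no (u ≟ x) u≢x) (if-yes (x ≟ x) refl)

        plan-coupling : IsCoupling G ρ σ plan
        plan-coupling =
          plan-by-cases (λ _ _ t → 0# ≤ t) 0≤r (λ v _ → 0≤σ v) (λ u _ → 0≤ρ u) (λ _ _ _ _ → ≤-refl) ,
          plan-row , plan-column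

        plan-optimal : cost G d plan ≤ 3 · 1# - dual
        plan-optimal = +-cancelʳ-≤ dual (subst₂ _≤_ (sym (cost+dual plan-coupling))
          (trans (trans (∑∑-constant 3) (cong (3 ·_) ∑ρ≡1)) (sym (diff-+ dual (3 · 1#))))
          (sum-mono-≤ λ u → sum-mono-≤ λ v → pointwise u v))
          where
          open Coupling plan-coupling

          Tight : Fin n → Fin n → ℝ → Set
          Tight u v t = load u v · t ≤ 3 · t

          pointwise : ∀ u v → Tight u v (plan u v)
          pointwise = plan-by-cases Tight (·-monoˡ-≤ 0≤r tight-xy) row column
            (λ u v _ _ → ·-at-zero (load u v) 3 refl)
            where
            row : ∀ v → v ≢ y → Tight x v (σ v)
            row v v≢y with supp-σ v
            ... | inj₁ σv≡0 = ·-at-zero (load x v) 3 σv≡0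
            ... | inj₂ nv   = ·-monoˡ-≤ (0≤σ v) (tight-row nv v≢y)

            column : ∀ u → u ≢ x → Tight u y (ρ u)
            column u u≢x with supp-ρ u
            ... | inj₁ ρu≡0 = ·-at-zero (load u y) 3 ρu≡0
            ... | inj₂ nu   = ·-monoˡ-≤ (0≤ρ u) (tight-column nu u≢x)

        isW₁ : IsW₁ G ρ σ (3 · 1# - dual)
        isW₁ = d , isDistance , (λ { (_ , coupling , refl) → W₁-≥ coupling }) ,
          λ b b≤ → ≤-trans (b≤ (plan , plan-coupling , refl)) plan-optimal

-- Curvature of a bridge, and admissibility as an inequality of weighted degrees.

module LocalCurvature (R : CompleteOrderedField) where
  open CompleteOrderedField R
  open OrderedField R
  open Curvature R
  open Transport R
  open Solver using (solve; _:=_; _:+_; _:*_; con)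

  module _ {n : ℕ} (G : Graph n) (𝓌 : Weight G) where
    open Graph G
    open Weight 𝓌

    D : Fin n → ℝ
    D = weightedDegree G 𝓌

    term : Fin n → Fin n → ℝ
    term x z = if does (x ~? z) then w x z else 0#

    0≤term : ∀ x z → 0# ≤ term x z
    0≤term x z with x ~? z
    ... | yes x~z = proj₁ (positive x~z)
    ... | no _    = ≤-refl

    w≤D : ∀ {x y} → x ~ y → w x y ≤ D x
    w≤D {x} {y} x~y = subst (_≤ D x) (if-yes (x ~? y) x~y) (term≤sum (0≤term x) y)

    w+w≤D : ∀ {x y z} → x ~ y → x ~ z → y ≢ z → w x y + w x z ≤ D x
    w+w≤D {x} {y} {z} x~y x~z y≢z = subst₂ (λ s t → s + t ≤ D x)
      (if-yes (x ~? y) x~y) (if-yes (x ~? z) x~z) (two-terms≤sum (0≤term x) y≢z)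

    0<D : ∀ {x y} → x ~ y → 0# < D x
    0<D x~y = <-≤-trans (positive x~y) (w≤D x~y)

    -- The inequality w(x,y) / D x + w(x,y) / D y ≥ 1, cleared of
    -- denominators.
    Balanced : Set
    Balanced = ∀ {x y} → x ~ y → D x * D y ≤ w x y * (D x + D y)

    μ-self : ∀ α x → μ G 𝓌 α x x ≡ α
    μ-self α x = if-yes (x ≟ x) refl

    μ-neighbour : ∀ α {x z} → x ~ z → μ G 𝓌 α x z ≡ (1# - α) * (w x z / D x)
    μ-neighbour α {x} {z} x~z = trans (if-no (z ≟ x) λ z≡x → ~-irrefl (sym z≡x) x~z)
      (trans (if-yes (x ~? z) x~z) (*-assoc (1# - α) (w x z) (D x ⁻¹)))

    μ-support : ∀ α x u → μ G 𝓌 α x u ≡ 0# ⊎ Near G x u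
    μ-support α x u with u ≟ x | x ~? u
    ... | yes u≡x | _       = inj₂ (inj₁ u≡x)
    ... | no _    | yes x~u = inj₂ (inj₂ x~u)
    ... | no _    | no _    = inj₁ refl

    0≤μ : ∀ {α x} → 0# ≤ α → α ≤ 1# → 0# < D x → ∀ u → 0# ≤ μ G 𝓌 α x u
    0≤μ {α} {x} 0≤α α≤1 0<Dx u with u ≟ x | x ~? u
    ... | yes _ | _       = 0≤α
    ... | no _  | yes x~u = *-nonNegative (*-nonNegative (0≤-diff α≤1) (proj₁ (positive x~u)))
                              (⁻¹-nonNegative 0<Dx)
    ... | no _  | no _    = ≤-refl

    ∑μ≡1 : ∀ α {x} → 0# < D x → sum (μ G 𝓌 α x) ≡ 1#
    ∑μ≡1 α {x} 0<Dx = begin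
      sum (μ G 𝓌 α x)
        ≡⟨ sum-extra {g = λ z → scale * term x z} x
             (trans (cong (scale *_) (if-no (x ~? x) (~-irrefl refl))) (zeroʳ scale)) pointwise ⟩
      μ G 𝓌 α x x + sum (λ z → scale * term x z)
        ≡⟨ cong₂ _+_ (μ-self α x) (sym (*-distribˡ-sum scale (term x))) ⟩
      α + scale * D x
        ≡⟨ cong (α +_) (/-*-cancel 0<Dx (1# - α)) ⟩
      α + (1# - α)
        ≡⟨ trans (+-comm α (1# - α)) (diff-+ α 1#) ⟩
      1# ∎
      where
      open ≡-Reasoning

      scale : ℝ
      scale = (1# - α) / D x

      pointwise : ∀ z → z ≢ x → μ G 𝓌 α x z ≡ scale * term x z
      pointwise z z≢x = trans (if-no (z ≟ x) z≢x) (by-cases (x ~? z))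
        where
        by-cases : (x~z? : Dec (x ~ z)) →
          (if does x~z? then (1# - α) * w x z / D x else 0#) ≡
          scale * (if does x~z? then w x z else 0#)
        by-cases (yes _) = solve 3 (λ b w i → b :* w :* i := b :* i :* w) refl (1# - α) (w x z) (D x ⁻¹)
        by-cases (no _)  = sym (zeroʳ scale)

    curvature : Fin n → Fin n → ℝ
    curvature x y = ((p + q) + (p + q)) - (1# + 1#)
      where
      p = w x y / D x
      q = w y x / D y

    1-W≡ : ∀ {α β p q} → β + α ≡ 1# →
      1# - (3 · 1# - ((α + (β * p + β * p)) + (α + (β * q + β * q)))) ≡
      β * (((p + q) + (p + q)) - (1# + 1#))
    -- Adding `W + T` to both sides removes every subtraction and leaves identities for the semiring
    -- solver. The trailing `0#` below comes from unfolding `3 · 1#`.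
    1-W≡ {α} {β} {p} {q} β+α≡1 = +-cancelʳ (W + T) _ _ (begin
      1# - W + (W + T)   ≡⟨ +-assoc (1# - W) W T ⟨
      1# - W + W + T     ≡⟨ cong (_+ T) (diff-+ W 1#) ⟩
      1# + T
        ≡⟨ cong (1# +_) (solve 4 (λ a b p q → (a :+ (b :* p :+ b :* p)) :+ (a :+ (b :* q :+ b :* q)) :=
             (a :+ a) :+ b :* ((p :+ q) :+ (p :+ q))) refl α β p q) ⟩
      1# + ((α + α) + β * ((p + q) + (p + q)))
        ≡⟨ cong (λ t → 1# + ((α + α) + β * t)) (diff-+ (1# + 1#) ((p + q) + (p + q))) ⟨
      1# + ((α + α) + β * (K + (1# + 1#)))
        ≡⟨ solve 3 (λ a b k → con 1 :+ ((a :+ a) :+ b :* (k :+ (con 1 :+ con 1))) :=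
             b :* k :+ (con 1 :+ ((b :+ a) :+ ((b :+ a) :+ con 0)))) refl α β K ⟩
      β * K + (1# + ((β + α) + ((β + α) + 0#)))
        ≡⟨ cong (λ t → β * K + (1# + (t + (t + 0#)))) β+α≡1 ⟩
      β * K + 3 · 1#     ≡⟨ cong (β * K +_) (diff-+ T (3 · 1#)) ⟨
      β * K + (W + T)    ∎)
      where
      open ≡-Reasoning
      T = (α + (β * p + β * p)) + (α + (β * q + β * q))
      W = 3 · 1# - T
      K = ((p + q) + (p + q)) - (1# + 1#)

    halve-≤ : ∀ {s t} → s + s ≤ t + t → s ≤ t
    halve-≤ {s} {t} 2s≤2t = *-cancelˡ-≤ (0<+ 0<1 0<1) (subst₂ _≤_ (double s) (double t) 2s≤2t)
      where
      double : ∀ a → a + a ≡ (1# + 1#) * a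
      double = solve 1 (λ a → a :+ a := (con 1 :+ con 1) :* a) refl

    near-one : ∀ {δ} → 0# < δ → ∃[ α ] 0# ≤ α × 1# - δ < α × α < 1#
    near-one {δ} 0<δ with δ ≤? 1#
    ... | no δ≰1 = 0# , ≤-refl ,
      <-balance (≰⇒> δ≰1) (trans (diff-+ δ 1#) (sym (+-identityˡ 1#))) , 0<1
    ... | yes δ≤1 = 1# - η , 0≤-diff (≤-trans (proj₁ η<δ) δ≤1) ,
      <-balance η<δ (trans (diff-+ δ 1#) (sym (diff-+ η 1#))) ,
      <-balance 0<η (trans (diff-+ η 1#) (sym (+-identityʳ 1#)))
      where
      η = δ * ½
      0<η : 0# < η
      0<η = 0<* 0<δ 0<½
      η<δ : η < δ
      η<δ = <-balance 0<η (trans (sym (distribˡ δ ½ ½))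
        (trans (cong (δ *_) ½+½≡1) (trans (*-identityʳ δ) (sym (+-identityʳ δ)))))

    module _ {x y : Fin n} (x~y : x ~ y) where
      private
        p = w x y / D x
        q = w y x / D y
        0<Dx = 0<D x~y
        0<Dy = 0<D (~-sym x~y)

      cleared : D x * D y * (p + q) ≡ w x y * (D x + D y)
      cleared = begin
        D x * D y * (p + q)
          ≡⟨ solve 4 (λ a b p q → a :* b :* (p :+ q) := (p :* a) :* b :+ (q :* b) :* a) refl (D x) (D y) p q ⟩
        p * D x * D y + q * D y * D x
          ≡⟨ cong₂ (λ s t → s * D y + t * D x) (/-*-cancel 0<Dx (w x y)) (/-*-cancel 0<Dy (w y x)) ⟩
        w x y * D y + w y x * D x
          ≡⟨ cong (λ t → w x y * D y + t * D x) (sym (w-sym x~y)) ⟩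
        w x y * D y + w x y * D x
          ≡⟨ solve 3 (λ w a b → w :* b :+ w :* a := w :* (a :+ b)) refl (w x y) (D x) (D y) ⟩
        w x y * (D x + D y) ∎
        where open ≡-Reasoning

      balanced⇒0≤curvature : D x * D y ≤ w x y * (D x + D y) → 0# ≤ curvature x y
      balanced⇒0≤curvature balanced = 0≤-diff (+-mono-≤ 1≤p+q 1≤p+q)
        where
        1≤p+q : 1# ≤ p + q
        1≤p+q = *-cancelˡ-≤ (0<* 0<Dx 0<Dy) (subst₂ _≤_ (sym (*-identityʳ _)) (sym cleared) balanced)

      0≤curvature⇒balanced : 0# ≤ curvature x y → D x * D y ≤ w x y * (D x + D y)
      0≤curvature⇒balanced 0≤K = subst₂ _≤_ (*-identityʳ _) cleared
        (*-monoʳ-≤ (proj₁ (0<* 0<Dx 0<Dy)) (halve-≤ (subst₂ _≤_ (+-identityˡ _) (diff-+ _ _)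
          (+-monoˡ-≤ (1# + 1#) 0≤K))))

      module _ (bridge : Bridge G x y) where

        module Measures (α : ℝ) {d : Fin n → Fin n → ℕ} (isDistance : IsDistance G d) where
          open Optimal G x~y bridge isDistance (∑μ≡1 α 0<Dx) (∑μ≡1 α 0<Dy)
            (μ-support α x) (μ-support α y) public

          curvature-at-α : 1# - (3 · 1# - dual) ≡ (1# - α) * curvature x y
          curvature-at-α = trans
            (cong (λ t → 1# - (3 · 1# - t)) (cong₂ _+_
              (cong₂ (λ s t → s + (t + t)) (μ-self α x) (μ-neighbour α x~y))
              (cong₂ (λ s t → s + (t + t)) (μ-self α y) (μ-neighbour α (~-sym x~y)))))
            (1-W≡ (diff-+ α 1#))

        -- Weak duality makes the dual value a lower bound of all transport costs, hence of `W`.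
        -- This one-sided estimate is what turns admissibility into `Balanced`.
        κ-upper : ∀ {α k} → Isκ G 𝓌 α x y k → k ≤ (1# - α) * curvature x y
        κ-upper {α} (W , (d , isDistance , _ , greatest) , refl) =
          subst (1# - W ≤_) curvature-at-α
            (+-monoʳ-≤ 1# (neg-antimono (greatest _ λ { (_ , coupling , refl) → W₁-≥ coupling })))
          where
          open Measures α isDistance
          neg-antimono : ∀ {s t} → s ≤ t → - t ≤ - s
          neg-antimono {s} {t} s≤t = ≤-balance s≤t
            (trans (-‿inverseˡ t) (sym (-‿inverseˡ s)))

        -- The optimal plan puts mass 2α - 1 on the pair of `x` and `y`; the condition on `α` makes
        -- it non-negative.
        κ-exact : ∀ {α d} → IsDistance G d → 1# ≤ α + α → α ≤ 1# →
                  Isκ G 𝓌 α x y ((1# - α) * curvature x y)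
        κ-exact {α} isDistance 1≤2α α≤1 =
          _ , isW₁ (0≤-diff 1≤2α) r+1 (0≤μ 0≤α α≤1 0<Dx) (0≤μ 0≤α α≤1 0<Dy) , sym curvature-at-α
          where
          open Measures α isDistance

          0≤α : 0# ≤ α
          0≤α = halve-≤ (≤-trans (≤-reflexive (+-identityˡ 0#)) (≤-trans 0≤1 1≤2α))

          r+1 : α + α - 1# + 1# ≡ μ G 𝓌 α x x + μ G 𝓌 α y y
          r+1 = trans (diff-+ 1# (α + α)) (sym (cong₂ _+_ (μ-self α x) (μ-self α y)))

        private
          0<β : ∀ {α} → α < 1# → 0# < 1# - α
          0<β {α} α<1 = <-balance α<1
            (trans (+-identityˡ 1#) (sym (diff-+ α 1#)))

          cancel-β : ∀ {α} → α < 1# → (1# - α) * curvature x y / (1# - α) ≡ curvature x y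
          cancel-β {α} α<1 =
            trans (solve 3 (λ b k i → b :* k :* i := k :* i :* b) refl (1# - α) (curvature x y) ((1# - α) ⁻¹))
              (/-*-cancel (0<β α<1) (curvature x y))

        -- The quotient in the limit is constant for `α` above one half, so `½` serves as the radius
        -- for every tolerance.
        curvature-κLLY : ∀ {d} → IsDistance G d → IsκLLY G 𝓌 x y (curvature x y)
        curvature-κLLY isDistance η 0<η = ½ , 0<½ , λ α _ 1-½<α α<1 →
          (1# - α) * curvature x y ,
          κ-exact isDistance (1≤2α (proj₁ 1-½<α)) (proj₁ α<1) ,
          subst (- η <_) (sym (difference α<1))
            (<-balance 0<η (trans (-‿inverseˡ η) (sym (+-identityˡ 0#)))) ,
          subst (_< η) (sym (difference α<1)) 0<η
          where
          1≤2α : ∀ {α} → 1# - ½ ≤ α → 1# ≤ α + α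
          1≤2α {α} 1-½≤α = subst (_≤ α + α) ½+½≡1 (+-mono-≤ ½≤α ½≤α)
            where
            ½≤α : ½ ≤ α
            ½≤α = +-cancelʳ-≤ ½ (subst₂ _≤_ (trans (diff-+ ½ 1#) (sym ½+½≡1)) refl (+-monoˡ-≤ ½ 1-½≤α))

          difference : ∀ {α} → α < 1# →
            (1# - α) * curvature x y / (1# - α) - curvature x y ≡ 0#
          difference α<1 = trans (cong (_- curvature x y) (cancel-β α<1)) (-‿inverseʳ _)

        -- If the curvature K were negative, the tolerance -K would yield some `α` with k/(1 - α) -
        -- κ > K. But k/(1 - α) ≤ K by `κ-upper`, and `κ` is non-negative.
        0≤κLLY⇒0≤curvature : ∀ {κ} → IsκLLY G 𝓌 x y κ → 0# ≤ κ → 0# ≤ curvature x y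
        0≤κLLY⇒0≤curvature {κ} lim 0≤κ with 0# ≤? curvature x y
        ... | yes 0≤K = 0≤K
        ... | no 0≰K
          with δ , 0<δ , approx ← lim (- curvature x y) (<-balance (≰⇒> 0≰K)
            (trans (+-identityˡ 0#) (sym (-‿inverseˡ _))))
          with α , 0≤α , 1-δ<α , α<1 ← near-one 0<δ
          with k , isκ , K<k/β-κ , _ ← approx α 0≤α 1-δ<α α<1 =
            contradiction k/β-κ≤K (<⇒≱ (subst (_< k / (1# - α) - κ) (-‿involutive (curvature x y)) K<k/β-κ))
          where
          k/β-κ≤K : k / (1# - α) - κ ≤ curvature x y
          k/β-κ≤K = ≤-trans (≤-balance 0≤κ (trans (diff-+ κ _) (sym (+-identityʳ _))))
            (subst (k / (1# - α) ≤_) (cancel-β α<1)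
              (*-monoˡ-≤ (⁻¹-nonNegative (0<β α<1)) (κ-upper isκ)))

    admissible⇒balanced : Bridged G → Admissible G 𝓌 → Balanced
    admissible⇒balanced bridged admissible x~y with κ , isκ , 0≤κ ← admissible x~y =
      0≤curvature⇒balanced x~y (0≤κLLY⇒0≤curvature x~y (bridged x~y) isκ 0≤κ)

    balanced⇒admissible : Bridged G → ∃ (IsDistance G) → Balanced → Admissible G 𝓌
    balanced⇒admissible bridged (d , isDistance) balanced {x} {y} x~y =
      curvature x y , curvature-κLLY x~y (bridged x~y) isDistance ,
      balanced⇒0≤curvature x~y (balanced x~y)

-- The weight on the suppressed graph.

module SuppressWeight (R : CompleteOrderedField) where
  open CompleteOrderedField R
  open OrderedField R
  open Curvature R
  open LocalCurvature R
  open Solver using (solve; _:=_; _:+_; _:*_; con)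

  -- Distortion is tracked through a fixed pair of bounds, since these pass unchanged through
  -- repeated suppressions; the supremum and infimum are formed again only for the final graph.
  Bounded : ∀ {n} (G : Graph n) → Weight G → ℝ → ℝ → Set
  Bounded G 𝓌 i s = ∀ {x y} → Graph._~_ G x y → i ≤ Weight.w 𝓌 x y × Weight.w 𝓌 x y ≤ s

  module _ {n : ℕ} {G : Graph (suc n)} {H : Graph n} (bridged : Bridged G)
           (walks : ∀ p q → ∃[ k ] Walk G k p q) (𝓌 : Weight G) (balanced : Balanced G 𝓌) where
    open Graph G
    open Graph H using () renaming (_~_ to _~ᴴ_; _~?_ to _~?ᴴ_)
    open Weight 𝓌

    private
      d : Fin (suc n) → ℝ
      d = D G 𝓌

    -- With A′ and B′ the weighted degrees of `p` and `q` diminished by W, the balance inequality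
    -- reads A′ B′ ≤ W². The inequations `o ≢ q` and `r ≢ p` make the outer edges contribute to A′
    -- and B′.
    log-concave : ∀ {o p q r} → p ~ o → p ~ q → q ~ r → o ≢ q → r ≢ p →
                  w p o * w q r ≤ w p q * w p q
    log-concave {o} {p} {q} {r} p~o p~q q~r o≢q r≢p = ≤-trans
      (≤-trans (*-monoˡ-≤ (proj₁ (positive q~r)) A≤) (*-monoʳ-≤ 0≤A′ B≤))
      (≤-balance (subst₂ (λ s t → s * t ≤ W * (s + t)) (sym (diff-+ W (d p))) (sym (diff-+ W (d q))) (balanced p~q))
        (solve 3 (λ a b w → a :* b :+ w :* ((a :+ w) :+ (b :+ w)) := w :* w :+ (a :+ w) :* (b :+ w))
          refl A′ B′ W))
      where
      W = w p q
      A′ = d p - W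
      B′ = d q - W
      A≤ : w p o ≤ A′
      A≤ = +-cancelʳ-≤ W (subst (w p o + W ≤_) (sym (diff-+ W (d p))) (w+w≤D G 𝓌 p~o p~q o≢q))
      B≤ : w q r ≤ B′
      B≤ = +-cancelʳ-≤ W (subst₂ _≤_ (cong (w q r +_) (w-sym (~-sym p~q))) (sym (diff-+ W (d q)))
             (w+w≤D G 𝓌 q~r (~-sym p~q) r≢p))
      0≤A′ = ≤-trans (proj₁ (positive p~o)) A≤

    -- Put e = X - a and f = V - (a + b). The first hypothesis becomes e (b + f) ≤ a², and e f ≥ 0
    -- leaves e b ≤ a²; adding a b gives the claim. It is applied to both edges at `v`, with `V` the
    -- weighted degree of `v`.
    degree-bound : ∀ {a b X V} → X * V ≤ a * (X + V) → a ≤ X → a + b ≤ V → X * b ≤ a * (a + b)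
    degree-bound {a} {b} {X} {V} h a≤X a+b≤V = subst (λ X → X * b ≤ a * (a + b)) X≡
      (≤-balance (+-mono-≤ (subst₂ (λ X V → X * V ≤ a * (X + V)) (sym X≡) (sym V≡) h)
                           (*-nonNegative (0≤-diff a≤X) (0≤-diff a+b≤V)))
        (solve 4 (λ a b e f →
            (e :+ a) :* b :+ (a :* ((e :+ a) :+ (f :+ (a :+ b))) :+ e :* f) :=
            a :* (a :+ b) :+ ((e :+ a) :* (f :+ (a :+ b)) :+ con 0))
          refl a b (X - a) (V - (a + b))))
      where
      X≡ = diff-+ a X
      V≡ = diff-+ (a + b) V

    -- Everything on the side of x is scaled by w(v,y) / w(x,v) ≥ 1, and
    -- the new edge inherits the weight of vy.
    module Oriented {v x y : Fin (suc n)} (S : Suppresses G v x y H)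
                    (a≤b : w x v ≤ w v y) where
      open Suppresses S
      open Cut S bridged

      private
        a b scale : ℝ
        a = w x v
        b = w v y
        scale = b / a

        0<a : 0# < a
        0<a = positive (~-sym v~x)
        0<b : 0# < b
        0<b = positive v~y

        scale*a : scale * a ≡ b
        scale*a = /-*-cancel 0<a b

        a*scale* : ∀ t → a * (scale * t) ≡ b * t
        a*scale* t = trans (solve 3 (λ a s t → a :* (s :* t) := s :* a :* t) refl a scale t)
          (cong (_* t) scale*a)

        0<scale : 0# < scale
        0<scale = *-nonNegative (proj₁ 0<b) (⁻¹-nonNegative 0<a) , λ 0≡scale →
          proj₂ 0<b (trans (sym (zeroˡ a)) (trans (cong (_* a) 0≡scale) scale*a))

      -- The edges op that a walk without backtracking starting with vx
      -- reaches in the direction from o to p.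
      data Away : Fin (suc n) → Fin (suc n) → Set where
        start : Away v x
        next  : ∀ {o p r} → Away o p → p ~ r → r ≢ o → Away p r

      away-edge : ∀ {o p} → Away o p → o ~ p
      away-edge start          = v~x
      away-edge (next _ p~r _) = p~r

      -- Log-concavity at vx gives b w(x,r) ≤ a², and then a ≤ b makes the first weight at most a.
      -- Further on, w(o,p) w(r,t) ≤ w(p,r)² ≤ w(p,r) w(o,p) shows that weights keep decreasing, so
      -- the first bound is inherited.
      away-decreasing : ∀ {o p r} → Away o p → p ~ r → r ≢ o →
                        b * w p r ≤ a * a × w p r ≤ w o p
      away-decreasing {r = r} start x~r r≢v =
        bw≤aa , subst (w x r ≤_) (sym wvx≡a)
          (*-cancelˡ-≤ 0<b (≤-trans bw≤aa (*-monoˡ-≤ (proj₁ 0<a) a≤b)))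
        where
        wvx≡a : w v x ≡ a
        wvx≡a = w-sym v~x
        bw≤aa : b * w x r ≤ a * a
        bw≤aa = subst (λ t → b * w x r ≤ t * t) wvx≡a (log-concave v~y v~x x~r (x≢y ∘ sym) r≢v)
      away-decreasing {r = t} (next {o} {p} {r} away p~r r≢o) r~t t≢p
        with bw≤aa , w≤ ← away-decreasing away p~r r≢o =
        ≤-trans (*-monoʳ-≤ (proj₁ 0<b) w′≤w) bw≤aa , w′≤w
        where
        o~p = away-edge away
        w′≤w : w r t ≤ w p r
        w′≤w = *-cancelˡ-≤ (positive o~p) (≤-trans
          (subst (λ s → s * w r t ≤ w p r * w p r) (w-sym (~-sym o~p))
            (log-concave (~-sym o~p) p~r r~t (r≢o ∘ sym) t≢p))
          (*-monoˡ-≤ (proj₁ (positive p~r)) w≤))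

      v-side : ∀ {p} → side p ≡ true → p ≢ v
      v-side sp refl with () ← trans (sym sp) side-y

      -- A walk from `x` to `p` is reduced on the way: a step back drops the last edge, and a return
      -- from the other side of the cut arrives at `x`, where the reduced walk starts afresh.
      reached : ∀ {p} → side p ≡ true → ∃[ o ] Away o p
      reached {p} = along (proj₂ (walks x p)) (λ _ → v , start)
        where
        extend : ∀ {u z} → u ~ z → (side u ≡ true → ∃[ o ] Away o u) → side z ≡ true → ∃[ o ] Away o z
        extend {u} {z} u~z ih sz with side u in su
        ... | false with refl , _ ← unique (~-sym u~z) sz su = v , start
        ... | true with ih refl
        ...   | o , away with z ≟ o
        ...     | no z≢o = u , next away u~z z≢o
        extend u~z ih sz | true | _ , start         | yes z≡v  = contradiction z≡v (v-side sz)
        extend u~z ih sz | true | _ , next away _ _ | yes refl = _ , away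

        along : ∀ {k u} → Walk G k u p → (side u ≡ true → ∃[ o ] Away o u) → side p ≡ true → ∃[ o ] Away o p
        along []      ih = ih
        along (e ∷ w) ih = along w (extend e ih)

      -- The edge either prolongs the reduced walk to `p` or is its last step; `away-decreasing`
      -- bounds it in both cases.
      x-side-small : ∀ {p q} → p ~ q → side p ≡ true → side q ≡ true → b * w p q ≤ a * a
      x-side-small {p} {q} p~q sp sq with reached sp
      ... | o , away with q ≟ o
      ...   | no q≢o = proj₁ (away-decreasing away p~q q≢o)
      x-side-small p~q sp sq | _ , start | yes q≡v = contradiction q≡v (v-side sq)
      x-side-small p~q sp sq | _ , next away o~p p≢o′ | yes refl =
        subst (λ t → b * t ≤ a * a) (w-sym o~p) (proj₁ (away-decreasing away o~p p≢o′))

      private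
        -- An edge of `H` whose ends have different sides is the new one, which explains the value
        -- `b`. The factor `1#` is written out so that both sides follow the formula of `mix-same`.
        mix : Bool → Bool → ℝ → ℝ
        mix true  true  t = scale * t
        mix true  false t = b
        mix false true  t = b
        mix false false t = 1# * t

        factor : Bool → ℝ
        factor true  = scale
        factor false = 1#

        mix-same : ∀ s t → mix s s t ≡ factor s * t
        mix-same true  _ = refl
        mix-same false _ = refl

        0<factor : ∀ s → 0# < factor s
        0<factor true  = 0<scale
        0<factor false = 0<1

        ι : Fin n → Fin (suc n)
        ι = punchIn v

        w′ : Fin n → Fin n → ℝ
        w′ p q = mix (side (ι p)) (side (ι q)) (w (ι p) (ι q))

        w′-old : ∀ {p q} → ι p ~ ι q → w′ p q ≡ factor (side (ι p)) * w (ι p) (ι q)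
        w′-old {p} {q} e = trans (cong (λ s → mix (side (ι p)) s (w (ι p) (ι q))) (sym (old-same-side e)))
          (mix-same (side (ι p)) _)

        w′-xy : ∀ {p q} → ι p ≡ x → ι q ≡ y → w′ p q ≡ b
        w′-xy {p} {q} p≡x q≡y = cong₂ (λ s t → mix s t (w (ι p) (ι q)))
          (trans (cong side p≡x) side-x) (trans (cong side q≡y) y-side)

        w′-yx : ∀ {p q} → ι p ≡ y → ι q ≡ x → w′ p q ≡ b
        w′-yx {p} {q} p≡y q≡x = cong₂ (λ s t → mix s t (w (ι p) (ι q)))
          (trans (cong side p≡y) y-side) (trans (cong side q≡x) side-x)

        w′-sym : ∀ {p q} → p ~ᴴ q → w′ p q ≡ w′ q p
        w′-sym {p} {q} e with edges e
        ... | inj₁ e′ = trans (w′-old e′) (trans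
          (cong₂ (λ s t → factor s * t) (old-same-side e′) (w-sym e′)) (sym (w′-old (~-sym e′))))
        ... | inj₂ (inj₁ (p≡x , q≡y)) = trans (w′-xy p≡x q≡y) (sym (w′-yx q≡y p≡x))
        ... | inj₂ (inj₂ (p≡y , q≡x)) = trans (w′-yx p≡y q≡x) (sym (w′-xy q≡x p≡y))

        w′-positive : ∀ {p q} → p ~ᴴ q → 0# < w′ p q
        w′-positive {p} e with edges e
        ... | inj₁ e′ = subst (0# <_) (sym (w′-old e′)) (0<* (0<factor (side (ι p))) (positive e′))
        ... | inj₂ (inj₁ (p≡x , q≡y)) = subst (0# <_) (sym (w′-xy p≡x q≡y)) 0<b
        ... | inj₂ (inj₂ (p≡y , q≡x)) = subst (0# <_) (sym (w′-yx p≡y q≡x)) 0<b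

      weight : Weight H
      weight = record { w = w′ ; w-sym = w′-sym ; positive = w′-positive }

      private
        d′ : Fin n → ℝ
        d′ = D H weight

        New : Fin n → Fin n → Set
        New p q = (ι p ≡ x × ι q ≡ y) ⊎ (ι p ≡ y × ι q ≡ x)

        term-old : ∀ {p q} → ¬ New p q → term H weight p q ≡ factor (side (ι p)) * term G 𝓌 (ι p) (ι q)
        term-old {p} {q} ¬new = by-cases (p ~?ᴴ q) (ι p ~? ι q)
          where
          by-cases : (e? : Dec (p ~ᴴ q)) (e′? : Dec (ι p ~ ι q)) →
            (if does e? then w′ p q else 0#) ≡
            factor (side (ι p)) * (if does e′? then w (ι p) (ι q) else 0#)
          by-cases (yes _) (yes e′) = w′-old e′
          by-cases (no _)  (no _)   = sym (zeroʳ _)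
          by-cases (no ¬e) (yes e′) = contradiction (old e′) ¬e
          by-cases (yes e) (no ¬e′) with edges e
          ... | inj₁ e′ = contradiction e′ ¬e′
          ... | inj₂ e″ = contradiction e″ ¬new

        -- The new edge to `c` takes the place of the lost edge to `v`. Its weight is that of the
        -- lost edge times the factor of the side, `scale * a` at `x` and `1# * w y v` at `y`, so
        -- the whole degree scales by that factor.
        degree-at-end : ∀ {p} c → p ~ᴴ c → ¬ ι p ~ ι c → (∀ q → q ≢ c → ¬ New p q) →
                        ι p ~ v → w′ p c ≡ factor (side (ι p)) * w (ι p) v →
                        d′ p ≡ factor (side (ι p)) * d (ι p)
        degree-at-end {p} c p~c ιp≁ιc ¬new ιp~v w′≡ = begin
          d′ p
            ≡⟨ sum-extra {g = λ q → f * t (ι q)} c (trans (cong (f *_) (if-no (ι p ~? ι c) ιp≁ιc)) (zeroʳ f))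
                 (λ q q≢c → term-old (¬new q q≢c)) ⟩
          term H weight p c + sum (λ q → f * t (ι q))
            ≡⟨ cong₂ _+_ (trans (if-yes (p ~?ᴴ c) p~c) (trans w′≡ (cong (f *_) (sym (if-yes (ι p ~? v) ιp~v)))))
                 (sym (*-distribˡ-sum f (t ∘ ι))) ⟩
          f * t v + f * sum (t ∘ ι) ≡⟨ distribˡ f _ _ ⟨
          f * (t v + sum (t ∘ ι))   ≡⟨ cong (f *_) (sum-remove t) ⟨
          f * d (ι p)               ∎
          where
          open ≡-Reasoning
          f = factor (side (ι p))
          t = term G 𝓌 (ι p)

        degree-inside : ∀ {p} → ι p ≢ x → ι p ≢ y → d′ p ≡ factor (side (ι p)) * d (ι p)
        degree-inside {p} p≢x p≢y = begin
          d′ p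
            ≡⟨ sum-cong-≗ {x = term H weight p} {y = λ q → f * t (ι q)} (λ q → term-old
                 λ { (inj₁ (p≡x , _)) → p≢x p≡x ; (inj₂ (p≡y , _)) → p≢y p≡y }) ⟩
          sum (λ q → f * t (ι q))  ≡⟨ *-distribˡ-sum f (t ∘ ι) ⟨
          f * sum (t ∘ ι)
            ≡⟨ cong (f *_) (trans (sym (+-identityˡ _)) (cong (_+ sum (t ∘ ι)) (sym (if-no (ι p ~? v) ιp≁v)))) ⟩
          f * (t v + sum (t ∘ ι))  ≡⟨ cong (f *_) (sum-remove t) ⟨
          f * d (ι p)              ∎
          where
          open ≡-Reasoning
          f = factor (side (ι p))
          t = term G 𝓌 (ι p)
          ιp≁v : ¬ ι p ~ v
          ιp≁v e with neighbours (~-sym e)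
          ... | inj₁ p≡x = p≢x p≡x
          ... | inj₂ p≡y = p≢y p≡y

        ιx : ι (punchOut v≢x) ≡ x
        ιx = punchIn-punchOut v≢x
        ιy : ι (punchOut v≢y) ≡ y
        ιy = punchIn-punchOut v≢y

        degree′ : ∀ p → d′ p ≡ factor (side (ι p)) * d (ι p)
        degree′ p with ι p ≟ x | ι p ≟ y
        ... | no p≢x  | no p≢y = degree-inside p≢x p≢y
        ... | yes p≡x | _ = degree-at-end (punchOut v≢y) (new p≡x ιy)
          (x≁y ∘ subst₂ _~_ p≡x ιy)
          (λ { q q≢y (inj₁ (_ , ιq≡y)) → q≢y (punchIn-injective v _ _ (trans ιq≡y (sym ιy)))
             ; q q≢y (inj₂ (p≡y , _)) → x≢y (trans (sym p≡x) p≡y) })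
          (subst (_~ v) (sym p≡x) (~-sym v~x))
          (trans (w′-xy p≡x ιy) (trans (sym scale*a)
            (cong₂ (λ s u → factor s * w u v) (sym (trans (cong side p≡x) side-x)) (sym p≡x))))
        ... | no _ | yes p≡y = degree-at-end (punchOut v≢x) (Graph.~-sym H (new ιx p≡y))
          (x≁y ∘ ~-sym ∘ subst₂ _~_ p≡y ιx)
          (λ { q q≢x (inj₂ (_ , ιq≡x)) → q≢x (punchIn-injective v _ _ (trans ιq≡x (sym ιx)))
             ; q q≢x (inj₁ (p≡x , _)) → x≢y (trans (sym p≡x) p≡y) })
          (subst (_~ v) (sym p≡y) (~-sym v~y))
          (trans (w′-yx p≡y ιx) (trans (w-sym v~y) (trans (sym (*-identityˡ (w y v)))
            (cong₂ (λ s u → factor s * w u v) (sym (trans (cong side p≡y) y-side)) (sym p≡y)))))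

        -- Write X and Y for the two new degrees. `degree-bound` at xv and vy yields X ≤ a + b and Y
        -- a ≤ b (b + a). The first times b Y plus the second times X is a + b times the claim.
        new-balanced : (scale * d x) * (1# * d y) ≤ b * (scale * d x + 1# * d y)
        new-balanced = subst (λ Y → X * Y ≤ b * (X + Y)) (sym (*-identityˡ Y))
          (*-cancelˡ-≤ (0<+ 0<a 0<b) (subst₂ _≤_
            (solve 4 (λ a b X Y → X :* (Y :* a) :+ X :* (b :* Y) := (a :+ b) :* (X :* Y)) refl a b X Y)
            (solve 4 (λ a b X Y → X :* (b :* (b :+ a)) :+ (a :+ b) :* (b :* Y) := (a :+ b) :* (b :* (X :+ Y)))
              refl a b X Y)
            (+-mono-≤ (*-monoʳ-≤ (proj₁ (0<* 0<scale (0<D G 𝓌 (~-sym v~x)))) Ya≤)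
                      (*-monoˡ-≤ (proj₁ (0<* 0<b (0<D G 𝓌 (~-sym v~y)))) X≤))))
          where
          X = scale * d x
          Y = d y
          wvx≡a = w-sym v~x

          X≤ : X ≤ a + b
          X≤ = *-cancelˡ-≤ 0<a (subst (_≤ a * (a + b)) (trans (*-comm (d x) b) (sym (a*scale* (d x))))
            (degree-bound (balanced (~-sym v~x)) (w≤D G 𝓌 (~-sym v~x))
              (subst (λ t → t + b ≤ d v) wvx≡a (w+w≤D G 𝓌 v~x v~y x≢y))))

          Ya≤ : Y * a ≤ b * (b + a)
          Ya≤ = degree-bound (subst₂ _≤_ (*-comm (d v) Y) (cong (b *_) (+-comm (d v) Y)) (balanced v~y))
            (subst (_≤ Y) (sym (w-sym v~y)) (w≤D G 𝓌 (~-sym v~y)))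
            (subst (λ t → b + t ≤ d v) wvx≡a (w+w≤D G 𝓌 v~y v~x (x≢y ∘ sym)))

      weight-balanced : Balanced H weight
      weight-balanced {p} {q} e = subst₂ (λ s t → s * t ≤ w′ p q * (s + t)) (sym (degree′ p)) (sym (degree′ q))
        (by-cases (edges e))
        where
        by-cases : ι p ~ ι q ⊎ New p q →
          factor (side (ι p)) * d (ι p) * (factor (side (ι q)) * d (ι q)) ≤
          w′ p q * (factor (side (ι p)) * d (ι p) + factor (side (ι q)) * d (ι q))
        -- Both ends have the same factor `f`, and the inequality is homogeneous of degree two, so
        -- the old one is multiplied by f².
        by-cases (inj₁ e′) rewrite w′-old e′ | sym (old-same-side e′) = subst₂ _≤_
          (solve 3 (λ f s t → f :* f :* (s :* t) := f :* s :* (f :* t)) refl f (d (ι p)) (d (ι q)))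
          (solve 4 (λ f w s t → f :* f :* (w :* (s :+ t)) := f :* w :* (f :* s :+ f :* t)) refl
            f (w (ι p) (ι q)) (d (ι p)) (d (ι q)))
          (*-monoʳ-≤ (0≤x*x f) (balanced e′))
          where f = factor (side (ι p))
        by-cases (inj₂ (inj₁ (p≡x , q≡y))) rewrite w′-xy p≡x q≡y | p≡x | q≡y | side-x | y-side = new-balanced
        by-cases (inj₂ (inj₂ (p≡y , q≡x))) rewrite w′-yx p≡y q≡x | p≡y | q≡x | side-x | y-side =
          subst₂ _≤_ (*-comm (scale * d x) (1# * d y)) (cong (b *_) (+-comm (scale * d x) (1# * d y))) new-balanced

      weight-bounded : ∀ {i s} → Bounded G 𝓌 i s → Bounded H weight i s
      weight-bounded {i} {s} bounded {p} {q} e with edges e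
      ... | inj₂ (inj₁ (p≡x , q≡y)) = subst (λ t → i ≤ t × t ≤ s) (sym (w′-xy p≡x q≡y)) (bounded v~y)
      ... | inj₂ (inj₂ (p≡y , q≡x)) = subst (λ t → i ≤ t × t ≤ s) (sym (w′-yx p≡y q≡x)) (bounded v~y)
      ... | inj₁ e′ = subst (λ t → i ≤ t × t ≤ s) (sym (w′-old e′)) (scaled (side (ι p)) refl)
        where
        W = w (ι p) (ι q)
        i≤W = proj₁ (bounded e′)
        scaled : ∀ σ → side (ι p) ≡ σ → i ≤ factor σ * W × factor σ * W ≤ s
        scaled false _ = subst (λ t → i ≤ t × t ≤ s) (sym (*-identityˡ W)) (bounded e′)
        scaled true sp = ≤-trans i≤W W≤scaled , ≤-trans scaled≤a (proj₂ (bounded (~-sym v~x)))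
          where
          W≤scaled : W ≤ scale * W
          W≤scaled = *-cancelˡ-≤ 0<a (subst (a * W ≤_) (sym (a*scale* W))
            (*-monoˡ-≤ (proj₁ (positive e′)) a≤b))
          scaled≤a : scale * W ≤ a
          scaled≤a = *-cancelˡ-≤ 0<a (subst (_≤ a * a) (sym (a*scale* W))
            (x-side-small e′ sp (trans (sym (old-same-side e′)) sp)))

    suppress-weight : ∀ {v x y i s} → Suppresses G v x y H → Bounded G 𝓌 i s →
                      ∃[ 𝓌′ ] Balanced H 𝓌′ × Bounded H 𝓌′ i s
    suppress-weight {v} {x} {y} S bounded with total (w x v) (w v y)
    ... | inj₁ a≤b = weight , weight-balanced , weight-bounded bounded
      where open Oriented S a≤b
    ... | inj₂ b≤a = weight , weight-balanced , weight-bounded bounded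
      where
      open Suppresses S
      open Oriented (swap-ends S) (subst₂ _≤_ (w-sym v~y) (sym (w-sym v~x)) b≤a)

-- Iterated suppression and comparison of the infima.

twoSuppression-hasEdge : ∀ {m n} {G : Graph m} {H : Graph n} →
                         TwoSuppression G H → HasEdge G → HasEdge H
twoSuppression-hasEdge (done _) edge = edge
twoSuppression-hasEdge {G = G} (step v x y x≢y deg v~x v~y t) _ =
  twoSuppression-hasEdge t (suppress-hasEdge (suppress-suppresses G x≢y deg v~x v~y))

twoSuppression-single : ∀ {n} {G : Graph 1} {H : Graph n} → TwoSuppression G H → n ≡ 1
twoSuppression-single         (done _) = refl
twoSuppression-single {G = G} (step zero zero _ _ _ v~v _ _) =
  contradiction v~v (Graph.~-irrefl G refl)

single-noEdge : (G : Graph 1) → ¬ HasEdge G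
single-noEdge G (zero , zero , e) = Graph.~-irrefl G refl e

module Monotonicity (R : CompleteOrderedField) where
  open CompleteOrderedField R
  open OrderedField R
  open Curvature R
  open LocalCurvature R
  open SuppressWeight R

  ≤∞-trans : ∀ {D E F} → D ≤∞ E → E ≤∞ F → D ≤∞ F
  ≤∞-trans _       (_ ≤⊤⁺) = _ ≤⊤⁺
  ≤∞-trans [ p ] [ q ]  = [ ≤-trans p q ]

  -- The induction runs on bridges and connectedness instead of `IsTree`: one suppression preserves
  -- them, and they provide both the weight and the distances on the final graph.
  twoSuppression-weight :
    ∀ {m n} {G : Graph m} {H : Graph n} → TwoSuppression G H →
    Bridged G → (∀ p q → ∃[ k ] Walk G k p q) →
    ∀ {i s} → (∃[ 𝓌 ] Balanced G 𝓌 × Bounded G 𝓌 i s) →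
    Bridged H × (∀ p q → ∃[ k ] Walk H k p q) × ∃[ 𝓌 ] Balanced H 𝓌 × Bounded H 𝓌 i s
  twoSuppression-weight (done _) bridged walks 𝓌 = bridged , walks , 𝓌
  twoSuppression-weight {G = G} (step v x y x≢y deg v~x v~y t) bridged walks (𝓌 , balanced , bounded) =
    twoSuppression-weight t (suppress-bridged S bridged) (suppress-connected S walks)
      (suppress-weight bridged walks 𝓌 balanced S bounded)
    where
    S = suppress-suppresses G x≢y deg v~x v~y

  edgeValue-sup : ∀ {n} (G : Graph n) (𝓌 : Weight G) {i s} → HasEdge G → Bounded G 𝓌 i s →
                  ∃ (IsSup _≤_ (EdgeValue G 𝓌))
  edgeValue-sup G 𝓌 {s = s} (x , y , e) bounded =
    complete (EdgeValue G 𝓌) (_ , x , y , e , refl) (s , λ { (_ , _ , e , refl) → proj₂ (bounded e) })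

  -- The infimum is obtained from completeness as the supremum of the lower bounds.
  edgeValue-inf : ∀ {n} (G : Graph n) (𝓌 : Weight G) {i s} → HasEdge G → Bounded G 𝓌 i s →
                  ∃ (IsInf _≤_ (EdgeValue G 𝓌))
  edgeValue-inf G 𝓌 {i} (x , y , e) bounded
    with g , upper , least ← complete (λ b → ∀ {r} → EdgeValue G 𝓌 r → b ≤ r)
           (i , λ { (_ , _ , e , refl) → proj₁ (bounded e) }) (_ , λ lb → lb (x , y , e , refl)) =
    g , (λ v → least _ λ lb → lb v) , λ b lb → upper lb

  bounded-distortion : ∀ {n} (G : Graph n) (𝓌 : Weight G) {i s} → HasEdge G → 0# < i →
                       Bounded G 𝓌 i s → ∃[ r ] IsDist G 𝓌 [ r ] × r ≤ s / i
  bounded-distortion G 𝓌 {i} {s} edge@(_ , _ , e) 0<i bounded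
    with s′ , sup ← edgeValue-sup G 𝓌 edge bounded | i′ , inf ← edgeValue-inf G 𝓌 edge bounded =
    s′ / i′ , finite sup inf 0<i′ ,
    ≤-trans (*-monoʳ-≤ 0≤s′ (⁻¹-antimono-≤ 0<i i≤i′))
            (*-monoˡ-≤ (⁻¹-nonNegative 0<i) (proj₂ sup s λ { (_ , _ , e , refl) → proj₂ (bounded e) }))
    where
    i≤i′ : i ≤ i′
    i≤i′ = proj₂ inf i λ { (_ , _ , e , refl) → proj₁ (bounded e) }
    0<i′ = <-≤-trans 0<i i≤i′
    0≤s′ : 0# ≤ s′
    0≤s′ = ≤-trans (proj₁ (Weight.positive 𝓌 e)) (proj₁ sup (_ , _ , e , refl))

  distortion-decreases :
    ∀ {m n} {T : Graph m} {T̄ : Graph n} → IsTree T → TwoSuppression T T̄ → HasEdge T̄ →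
    ∀ {r} → AdmissibleDist T [ r ] → ∃[ r′ ] AdmissibleDist T̄ [ r′ ] × r′ ≤ r
  distortion-decreases {T = T} {T̄} tree t edge (𝓌 , admissible , finite {s} {i} sup inf 0<i)
    with bridged , walks , 𝓌′ , balanced , bounded ← twoSuppression-weight t (tree-bridged T tree)
           (proj₂ (proj₁ tree))
           (𝓌 , admissible⇒balanced T 𝓌 (tree-bridged T tree) admissible ,
            λ e → proj₁ inf (_ , _ , e , refl) , proj₁ sup (_ , _ , e , refl))
    with r′ , dist , r′≤ ← bounded-distortion T̄ 𝓌′ edge 0<i bounded =
    r′ , (𝓌′ , balanced⇒admissible T̄ 𝓌′ bridged (distance T̄ walks) balanced , dist) , r′≤

theorem1p4 : (R : CompleteOrderedField) (let open CompleteOrderedField R) (let open Curvature R)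
    {m n : ℕ} (T : Graph m) (T̄ : Graph n) → IsTree T → TwoSuppression T T̄ →
    ∀ D D̄ → IsDN T D → IsDN T̄ D̄ → D̄ ≤∞ D
theorem1p4 R T T̄ tree t _ _ (Curvature.single refl) dn̄ with twoSuppression-single t | dn̄
... | refl | Curvature.single _       = [ ≤-refl ]
  where
  open CompleteOrderedField R
  open OrderedField R
... | refl | Curvature.infimum edge _ = contradiction edge (single-noEdge T̄)
theorem1p4 R T T̄ tree t _ _ (Curvature.infimum edge _) (Curvature.single refl) =
  contradiction (twoSuppression-hasEdge t edge) (single-noEdge T̄)
theorem1p4 R T T̄ tree t _ _ (Curvature.infimum _ (_ , greatest)) (Curvature.infimum edge (lower , _)) =
  -- It suffices that the invariant of `T̄` is a lower bound for the admissible distortions of `T`.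
  -- Infinite ones are trivial; a finite one dominates an admissible distortion of `T̄`.
  greatest _ bound
  where
  open CompleteOrderedField R
  open Curvature R
  open Monotonicity R

  bound : ∀ {D} → AdmissibleDist T D → _ ≤∞ D
  bound {⊤⁺}    _  = _ ≤⊤⁺
  bound {[ r ]} Dr with r′ , Dr′ , r′≤r ← distortion-decreases tree t edge Dr =
    ≤∞-trans (lower Dr′) [ r′≤r ]
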